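{- Let $n\geq 7$ be odd. Then the directed Cayley graph $\mathcal{A}_n$ of the alternating group $A_n$ with generators $\tau_3,\tau_5,\ldots,\tau_n$ has a directed Hamiltonian cycle. Consequently $M_n=n!/2$.
   Context: $S_n$ is the symmetric group of permutations $\pi=[\pi(1),\ldots,\pi(n)]$ of $[n]=\{1,\ldots,n\}$, with composition $(\pi\rho)(i)=\pi(\rho(i))$. For $2\leq k\leq n$, $\tau_k:=[k,1,2,\ldots,k-1,k+1,\ldots,n]\in S_n$ (the permutation that jumps element $k$ to position $1$, shifting $1,\ldots,k-1$ right by one). For odd $k$, $\tau_k\in A_n$. The directed Cayley graph $\mathcal{A}_n$ has vertex set $A_n$ and a directed edge from $\pi$ to $\pi\tau_k$ for each $\pi\in A_n$ and each odd $k\in\{3,5,\ldots,n\}$. Similarly $\mathcal{S}_n$ is the directed Cayley graph of $S_n$ with generators $\tau_2,\ldots,\tau_n$. A cycle means a self-avoiding directed cycle. The Kendall tau distance $d(\pi,\sigma)$ is the inversion number of $\pi^{ -1}\sigma$, i.e. the minimum number of elementary transpositions (swapping entries in positions $i,i+1$) needed to get from $\pi$ to $\sigma$. $M_n$ denotes the maximum length of a self-avoiding directed cycle in $\mathcal{S}_n$ containing no two permutations at Kendall tau distance $1$. -}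

module Defs where

open import Data.Nat using (ℕ; zero; suc; _+_; _∸_; _≤_; _<_; _<?_; _%_; _/_; _<ᵇ_; _≡ᵇ_)

open import Data.Bool using (Bool; true; false; if_then_else_; _∧_)
open import Data.Fin using (Fin; toℕ; fromℕ<)
open import Data.Fin.Properties using () renaming (_≟_ to _≟ᶠ_)
open import Data.Vec using (Vec; lookup; tabulate; toList)
open import Data.List using (List; []; _∷_; _++_; [_]; length; map; allFin)
open import Data.Nat.ListAction using (sum)
open import Data.List.Relation.Unary.All using (All)
open import Data.List.Relation.Unary.Linked using (Linked)
open import Data.List.Relation.Unary.Unique.Propositional using (Unique)
open import Data.List.Membership.Propositional using (_∈_)
open import Data.Product using (Σ; ∃; _×_)
open import Relation.Nullary using (¬_; yes; no)
open import Relation.Nullary.Decidable using (⌊_⌋)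
open import Relation.Binary.PropositionalEquality using (_≡_; _≢_)

-- A permutation of [n] in one-line notation, 0-indexed:
-- position i (0 ≤ i < n) holds the value π(i+1)-1.
Perm : ℕ → Set
Perm n = Vec (Fin n) n

IsPerm : ∀ {n} → Perm n → Set
IsPerm π = Unique (toList π)

_∘ₚ_ : ∀ {n} → Perm n → Perm n → Perm n
π ∘ₚ ρ = tabulate (λ i → lookup π (lookup ρ i))

-- position of value v in π (v itself if absent; never happens for permutations)
pos : ∀ {n} → Perm n → Fin n → Fin n
pos {n} π v = go (allFin n)
  where
  go : List (Fin n) → Fin n
  go [] = v
  go (i ∷ is) = if ⌊ lookup π i ≟ᶠ v ⌋ then i else go is

inverse : ∀ {n} → Perm n → Perm n
inverse π = tabulate (pos π)

invNum : ∀ {n} → Perm n → ℕ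
invNum {n} π =
  sum (map (λ i → sum (map (λ j →
    if (toℕ i <ᵇ toℕ j) ∧ (toℕ (lookup π j) <ᵇ toℕ (lookup π i)) then 1 else 0)
    (allFin n))) (allFin n))

IsEven : ∀ {n} → Perm n → Set
IsEven π = invNum π % 2 ≡ 0

InA : ∀ {n} → Perm n → Set
InA π = IsPerm π × IsEven π

kendall : ∀ {n} → Perm n → Perm n → ℕ
kendall π σ = invNum (inverse π ∘ₚ σ)

-- τ_k (1-indexed): τ_k(1) = k, τ_k(i) = i-1 for 2 ≤ i ≤ k, τ_k(i) = i for i > k.
-- 0-indexed version on ℕ:
tauℕ : ℕ → ℕ → ℕ
tauℕ k zero = k ∸ 1
tauℕ k (suc i) = if suc i <ᵇ k then i else suc i

-- convert back to Fin n (fallback only used when out of range, i.e. never for 2 ≤ k ≤ n)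
toFinOr : ∀ {n} → ℕ → Fin n → Fin n
toFinOr {n} m d with m <? n
... | yes p = fromℕ< p
... | no _ = d

tau : (n k : ℕ) → Perm n
tau n k = tabulate (λ i → toFinOr (tauℕ k (toℕ i)) i)

EdgeA : (n : ℕ) → Perm n → Perm n → Set
EdgeA n π σ = ∃ λ k → (k % 2 ≡ 1) × (3 ≤ k) × (k ≤ n) × (σ ≡ π ∘ₚ tau n k)

EdgeS : (n : ℕ) → Perm n → Perm n → Set
EdgeS n π σ = ∃ λ k → (2 ≤ k) × (k ≤ n) × (σ ≡ π ∘ₚ tau n k)

CycLinked : ∀ {A : Set} → (A → A → Set) → List A → Set
CycLinked R [] = Linked R []
CycLinked R (x ∷ xs) = Linked R ((x ∷ xs) ++ [ x ])

IsCycle : ∀ {A : Set} → (A → Set) → (A → A → Set) → List A → Set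
IsCycle V E c = (1 ≤ length c) × All V c × Unique c × CycLinked E c

IsHamCycleA : (n : ℕ) → List (Perm n) → Set
IsHamCycleA n c = IsCycle InA (EdgeA n) c × (∀ π → InA π → π ∈ c)

IsGoodCycleS : (n : ℕ) → List (Perm n) → Set
IsGoodCycleS n c = IsCycle IsPerm (EdgeS n) c
                 × (∀ π σ → π ∈ c → σ ∈ c → kendall π σ ≢ 1)

MaxGoodCycleLength : ℕ → ℕ → Set
MaxGoodCycleLength n m =
  (∃ λ c → IsGoodCycleS n c × length c ≡ m)
  × (∀ c → IsGoodCycleS n c → length c ≤ m)

{-# OPTIONS --safe #-}
-- Permutations are words, and τ_k jumps the k-th letter to the front. The cosets of A_{n-2} in A_n are
-- the sets of even words with given last two letters y z, and each carries a copy of a Hamiltonian cycle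
-- of A_{n-2}. If the words Wxyz, Wzxy, Wyzx all use τ_{n-2} in their cosets, then letting them use τ_n
-- instead splices the cycles of the cosets (y,z), (x,y), (z,x) into one. Every coset has a word Wxyz
-- using τ_{n-2} for each x, because a Hamiltonian cycle of A_{n-2} must leave the words ending in x; and
-- since the copy placed on a coset may be relabelled, one of its words using τ_{n-2} may be prescribed.
-- So it suffices to reach all n(n-1) ordered pairs by directed triangles. As n(n-1) is even and a triangle
-- adds two pairs, this fails from a single coset, but it succeeds from six cosets spliced at once at
--   U01234, U40123, U34012, U34201, U13420, U01342,
-- where the first and fourth word use τ_{n-2}, the others τ_{n-4}, and all of them τ_n afterwards.
-- The induction starts from an explicit cycle for n = 7.
--
-- Even permutations have even Kendall distance. Conversely a cycle without two permutations at
-- distance 1 contains at most one of π and π(1 2), hence has at most n!/2 elements.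

module Submission where

open import Defs
open import Data.Bool using (Bool; true; false; _xor_; not; if_then_else_; _∧_)
open import Data.Bool.Properties as Bool using (xor-assoc; xor-same; not-involutive; ¬-not)
open import Data.Bool.Solver using (module xor-∧-Solver)
open import Data.Empty using (⊥)
open import Data.Fin using (Fin; toℕ) renaming (zero to fzero; suc to fsuc)
open import Data.Fin.Properties using (toℕ-injective; toℕ<n; toℕ-fromℕ<) renaming (_≟_ to _≟ᶠ_)
open import Data.List as List using (List; []; _∷_; _++_; [_]; map; length; _∷ʳ_; initLast; _∷ʳ′_; applyUpTo; upTo; allFin; concatMap; foldl; drop; filter)
import Data.List.Membership.DecPropositional as DecMembership
open import Data.List.Membership.Propositional using (_∈_; _∉_; lose)
open import Data.List.Membership.Propositional.Properties using (∈-++⁺ˡ; ∈-++⁺ʳ; ∈-++⁻; ∈-∃++; ∈-map⁺; ∈-map⁻; ∈-applyUpTo⁺; ∈-applyUpTo⁻; ∈-concatMap⁺; ∈-filter⁺; ∈-upTo⁺; ∈-upTo⁻; ∈-allFin)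
open import Data.List.Properties as List using (map-++; length-++; ++-assoc; ++-identityʳ; length-map; map-id; map-∘; ∷ʳ-injective; ∷-injective; ++-cancelʳ; length-applyUpTo; upTo-∷ʳ; length-upTo)
open import Data.List.Relation.Binary.Permutation.Propositional using (_↭_; refl; prep; swap; ↭-sym; ↭-refl; ↭-trans; ↭⇒↭ₛ) renaming (trans to compose)
open import Data.List.Relation.Binary.Permutation.Propositional.Properties using (∈-resp-↭; ↭-length; ↭-empty-inv; shift; shifts; drop-∷; ++-comm; ++⁺ˡ; ++⁺ʳ; map⁺)
import Data.List.Relation.Binary.Permutation.Setoid.Properties as Permₛ
open import Data.List.Relation.Unary.All as All using (All; []; _∷_)
open import Data.List.Relation.Unary.AllPairs using ([]; _∷_)
open import Data.List.Relation.Unary.Any using (here; there)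
open import Data.List.Relation.Unary.Linked as Linked using (Linked; [-]; _∷_)
open import Data.List.Relation.Unary.Unique.Propositional using (Unique)
import Data.List.Relation.Unary.Unique.Propositional.Properties as Unique
open import Data.Nat using (ℕ; zero; suc; _+_; _*_; _≤_; _<_; _<ᵇ_; _<?_; _/_; _%_; _!; z≤n; s≤s)
open import Data.Nat.DivMod using (m*n/n≡m)
open import Data.Nat.ListAction using (sum)
open import Data.Nat.Properties
open import Data.Product using (∃; ∃₂; _×_; _,_; proj₁; proj₂)
open import Data.Product.Properties using (≡-dec; ,-injective)
open import Data.Sum using (_⊎_; inj₁; inj₂)
open import Data.Unit using (⊤; tt)
open import Data.Vec using (Vec; lookup; tabulate; toList; []; _∷_)
open import Data.Vec.Properties using (lookup∘tabulate; tabulate∘lookup; tabulate-cong; length-toList)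
open import Function using (_∘_; id)
open import Relation.Binary using (tri<; tri≈; tri>)
open import Relation.Binary.PropositionalEquality using (_≡_; _≢_; refl; sym; trans; cong; cong₂; subst; subst₂; setoid; module ≡-Reasoning)
open import Relation.Nullary using (¬_; Dec; yes; no; contradiction)
open import Relation.Nullary.Decidable using (map′; True; False; toWitness; toWitnessFalse; ¬?; _×-dec_; _→-dec_)

-- Lists without repetition

Unique-resp-↭ : ∀ {A : Set} {xs ys : List A} → xs ↭ ys → Unique xs → Unique ys
Unique-resp-↭ {A} p = Permₛ.Unique-resp-↭ (setoid A) (↭⇒↭ₛ p)

unique-head : ∀ {A : Set} {x : A} {xs} → Unique (x ∷ xs) → x ∉ xs
unique-head (x≢ ∷ _) x∈ = All.lookup x≢ x∈ refl

unique-tail : ∀ {A : Set} {x : A} {xs} → Unique (x ∷ xs) → Unique xs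
unique-tail (_ ∷ u) = u

unique-prefix : ∀ {A : Set} (xs : List A) {ys} → Unique (xs ++ ys) → Unique xs
unique-prefix [] u = []
unique-prefix (x ∷ xs) (x≢ ∷ u) =
  All.tabulate (λ y∈ → All.lookup x≢ (∈-++⁺ˡ y∈)) ∷ unique-prefix xs u

unique-disjoint : ∀ {A : Set} (xs : List A) {ys x} → Unique (xs ++ ys) → x ∈ xs → x ∉ ys
unique-disjoint (x ∷ xs) u (here refl) x∈ys = unique-head u (∈-++⁺ʳ xs x∈ys)
unique-disjoint (x ∷ xs) u (there x∈)  x∈ys = unique-disjoint xs (unique-tail u) x∈ x∈ys

unique-map : ∀ {A B : Set} (f : A → B) (g : B → A) {xs} →
  (∀ {x} → x ∈ xs → g (f x) ≡ x) → Unique xs → Unique (map f xs)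
unique-map f g inv [] = []
unique-map f g {x ∷ xs} inv (x≢ ∷ u) = All.tabulate fresh ∷ unique-map f g (inv ∘ there) u
  where
  fresh : ∀ {b} → b ∈ map f xs → f x ≢ b
  fresh b∈ refl with ∈-map⁻ f b∈
  ... | y , y∈ , eq = All.lookup x≢ y∈
    (trans (sym (inv (here refl))) (trans (cong g eq) (inv (there y∈))))

subset-remove : ∀ {A : Set} {x : A} {xs ys ys′} → x ∉ xs → ys ↭ x ∷ ys′ →
  (∀ {y} → y ∈ xs → y ∈ ys) → ∀ {y} → y ∈ xs → y ∈ ys′
subset-remove x∉ p sub y∈ with ∈-resp-↭ p (sub y∈)
... | here refl = contradiction y∈ x∉
... | there y∈′ = y∈′

extract : ∀ {A : Set} {x : A} {ys} → x ∈ ys → ∃ λ ys′ → ys ↭ x ∷ ys′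
extract x∈ with ∈-∃++ x∈
... | as , bs , refl = as ++ bs , shift _ as bs

unique-⊆-length : ∀ {A : Set} {xs ys : List A} → Unique xs →
  (∀ {y} → y ∈ xs → y ∈ ys) → length xs ≤ length ys
unique-⊆-length {xs = []} u sub = z≤n
unique-⊆-length {xs = x ∷ xs} u sub with extract (sub (here refl))
... | ys′ , p = ≤-trans
  (s≤s (unique-⊆-length (unique-tail u) (subset-remove (unique-head u) p (sub ∘ there))))
  (≤-reflexive (sym (↭-length p)))

-- Pigeonhole. Through it equal lengths yield completeness, both for the explicit cycle on seven
-- letters and for permutations as rearrangements of `upTo n`.
unique-⊆-↭ : ∀ {A : Set} {xs ys : List A} → Unique xs →
  (∀ {y} → y ∈ xs → y ∈ ys) → length xs ≡ length ys → xs ↭ ys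
unique-⊆-↭ {xs = []} {[]} u sub len = refl
unique-⊆-↭ {xs = x ∷ xs} u sub len with extract (sub (here refl))
... | ys′ , p = ↭-trans
  (prep x (unique-⊆-↭ (unique-tail u) (subset-remove (unique-head u) p (sub ∘ there))
    (suc-injective (trans len (↭-length p)))))
  (↭-sym p)

↭-cancelˡ : ∀ {A : Set} (s : List A) {u v} → s ++ u ↭ s ++ v → u ↭ v
↭-cancelˡ []      p = p
↭-cancelˡ (x ∷ s) p = ↭-cancelˡ s (drop-∷ p)

-- Parity of the number of inversions

Word : Set
Word = List ℕ

-- Inversions are counted modulo 2 from the start, so sums become `xor` and the identities needed
-- are settled by a ring solver.
below : ℕ → Word → Bool
below x []       = false
below x (y ∷ ys) = (y <ᵇ x) xor below x ys

par : Word → Bool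
par []       = false
par (x ∷ xs) = below x xs xor par xs

open xor-∧-Solver using (solve; _:+_; _:=_; con)

<ᵇ-true : ∀ {m n} → m < n → (m <ᵇ n) ≡ true
<ᵇ-true {m} {n} m<n with m <ᵇ n | <⇒<ᵇ m<n
... | true | _ = refl

<ᵇ-false : ∀ {m n} → ¬ (m < n) → (m <ᵇ n) ≡ false
<ᵇ-false {m} {n} m≮n with m <ᵇ n | <ᵇ⇒< m n
... | true  | f = contradiction (f _) m≮n
... | false | _ = refl

<ᵇ-flip : ∀ {x y} → x ≢ y → (y <ᵇ x) ≡ not (x <ᵇ y)
<ᵇ-flip {x} {y} x≢y with <-cmp x y
... | tri< x<y _ y≮x = trans (<ᵇ-false y≮x) (cong not (sym (<ᵇ-true x<y)))
... | tri≈ _ x≡y _   = contradiction x≡y x≢y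
... | tri> x≮y _ y<x = trans (<ᵇ-true y<x) (cong not (sym (<ᵇ-false x≮y)))

below-↭ : ∀ x {u v} → u ↭ v → below x u ≡ below x v
below-↭ x refl        = refl
below-↭ x (prep y p)  = cong ((y <ᵇ x) xor_) (below-↭ x p)
below-↭ x (swap {xs = u} {ys = v} y z p) = trans
  (cong (λ b → (y <ᵇ x) xor ((z <ᵇ x) xor b)) (below-↭ x p))
  (solve 3 (λ a b c → a :+ (b :+ c) := b :+ (a :+ c)) refl (y <ᵇ x) (z <ᵇ x) (below x v))
below-↭ x (compose p q) = trans (below-↭ x p) (below-↭ x q)

par-swap : ∀ {x y} u → x ≢ y → par (y ∷ x ∷ u) ≡ not (par (x ∷ y ∷ u))
par-swap {x} {y} u x≢y = trans
  (cong (λ b → (b xor below y u) xor (below x u xor par u)) (trans (sym (not-involutive _)) (cong not (sym (<ᵇ-flip x≢y)))))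
  (solve 4 (λ a b c d → ((con true :+ a) :+ b) :+ (c :+ d) := con true :+ ((a :+ c) :+ (b :+ d)))
    refl (y <ᵇ x) (below y u) (below x u) (par u))

-- The sign of a rearrangement does not depend on how its letters are named: along a derivation of
-- `u ↭ v`, every exchange of neighbours reverses the parity under either naming, as both are
-- injective on the letters. This serves to relabel tours and to find the sign of π⁻¹σ.
relabel : ∀ {A : Set} (f g : A → ℕ) {u v : List A} → u ↭ v → Unique (map f u) → Unique (map g u) →
  par (map f u) xor par (map f v) ≡ par (map g u) xor par (map g v)
relabel f g {u} refl uf ug = trans (xor-same (par (map f u))) (sym (xor-same (par (map g u))))
relabel f g (prep {xs = u} {ys = v} x p) (_ ∷ uf) (_ ∷ ug) =
  trans (cancel f) (trans (relabel f g p uf ug) (sym (cancel g)))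
  where
  cancel : ∀ h → par (map h (x ∷ u)) xor par (map h (x ∷ v)) ≡ par (map h u) xor par (map h v)
  cancel h = trans
    (cong (λ b → (b xor par (map h u)) xor (below (h x) (map h v) xor par (map h v))) (below-↭ (h x) (map⁺ h p)))
    (solve 3 (λ a b c → (a :+ b) :+ (a :+ c) := b :+ c) refl
      (below (h x) (map h v)) (par (map h u)) (par (map h v)))
relabel f g (swap {xs = u} {ys = v} x y p) ((x≢ ∷ _) ∷ _ ∷ uf) ((x≢′ ∷ _) ∷ _ ∷ ug) =
  trans (cancel f x≢) (trans (cong not (relabel f g p uf ug)) (sym (cancel g x≢′)))
  where
  cancel : ∀ h → h x ≢ h y →
    par (map h (x ∷ y ∷ u)) xor par (map h (y ∷ x ∷ v)) ≡ not (par (map h u) xor par (map h v))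
  cancel h hx≢hy = trans
    (cong₂ _xor_
      (cong₂ (λ b c → ((h y <ᵇ h x) xor b) xor (c xor par (map h u)))
        (below-↭ (h x) (map⁺ h p)) (below-↭ (h y) (map⁺ h p)))
      (par-swap (map h v) hx≢hy))
    (solve 5 (λ a b c d e → ((a :+ b) :+ (c :+ d)) :+ (con true :+ ((a :+ b) :+ (c :+ e)))
        := con true :+ (d :+ e)) refl
      (h y <ᵇ h x) (below (h x) (map h v)) (below (h y) (map h v)) (par (map h u)) (par (map h v)))
relabel f g (compose {xs = u} {ys = v} {zs = w} p q) uf ug = trans (split f)
  (trans (cong₂ _xor_ (relabel f g p uf ug)
    (relabel f g q (Unique-resp-↭ (map⁺ f p) uf) (Unique-resp-↭ (map⁺ g p) ug)))
  (sym (split g)))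
  where
  split : ∀ h → par (map h u) xor par (map h w) ≡
    (par (map h u) xor par (map h v)) xor (par (map h v) xor par (map h w))
  split h = solve 3 (λ a b c → a :+ c := (a :+ b) :+ (b :+ c)) refl
    (par (map h u)) (par (map h v)) (par (map h w))

-- Parity of the inversions between `u` and `v`. It depends only on the letters on either side, so a
-- common prefix or suffix does not affect whether a rearrangement is even.
cross : Word → Word → Bool
cross []      v = false
cross (x ∷ u) v = below x v xor cross u v

below-++ : ∀ x u v → below x (u ++ v) ≡ below x u xor below x v
below-++ x []      v = refl
below-++ x (y ∷ u) v = trans (cong ((y <ᵇ x) xor_) (below-++ x u v)) (sym (xor-assoc (y <ᵇ x) _ _))

par-++ : ∀ u v → par (u ++ v) ≡ par u xor (cross u v xor par v)
par-++ []      v = refl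
par-++ (x ∷ u) v = trans (cong₂ _xor_ (below-++ x u v) (par-++ u v))
  (solve 5 (λ a b c d e → (a :+ b) :+ (c :+ (d :+ e)) := (a :+ c) :+ ((b :+ d) :+ e)) refl
    (below x u) (below x v) (par u) (cross u v) (par v))

cross-↭ˡ : ∀ {u u′} v → u ↭ u′ → cross u v ≡ cross u′ v
cross-↭ˡ v refl = refl
cross-↭ˡ v (prep x p) = cong (below x v xor_) (cross-↭ˡ v p)
cross-↭ˡ v (swap {ys = u′} x y p) = trans
  (cong (λ b → below x v xor (below y v xor b)) (cross-↭ˡ v p))
  (solve 3 (λ a b c → a :+ (b :+ c) := b :+ (a :+ c)) refl (below x v) (below y v) (cross u′ v))
cross-↭ˡ v (compose p q) = trans (cross-↭ˡ v p) (cross-↭ˡ v q)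

cross-↭ʳ : ∀ u {v v′} → v ↭ v′ → cross u v ≡ cross u v′
cross-↭ʳ []      p = refl
cross-↭ʳ (x ∷ u) p = cong₂ _xor_ (below-↭ x p) (cross-↭ʳ u p)

-- Even rearrangements

infix 4 _~_

record _~_ (u v : Word) : Set where
  constructor _,_
  field
    perm   : u ↭ v
    parity : par u ≡ par v

open _~_ public

~-refl : ∀ {u} → u ~ u
~-refl = ↭-refl , refl

~-sym : ∀ {u v} → u ~ v → v ~ u
~-sym (p , e) = ↭-sym p , sym e

~-trans : ∀ {u v w} → u ~ v → v ~ w → u ~ w
~-trans (p , e) (q , f) = ↭-trans p q , trans e f

~-reflexive : ∀ {u v} → u ≡ v → u ~ v
~-reflexive refl = ~-refl

~-unique : ∀ {u v} → u ~ v → Unique u → Unique v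
~-unique e = Unique-resp-↭ (perm e)

~-++ˡ : ∀ s {u v} → u ~ v → s ++ u ~ s ++ v
~-++ˡ s {u} {v} (p , e) = ++⁺ˡ s p ,
  trans (par-++ s u) (trans (cong₂ (λ b c → par s xor (b xor c)) (cross-↭ʳ s p) e) (sym (par-++ s v)))

~-++ʳ : ∀ {u v} s → u ~ v → u ++ s ~ v ++ s
~-++ʳ {u} {v} s (p , e) = ++⁺ʳ s p ,
  trans (par-++ u s) (trans (cong₂ (λ b c → b xor (c xor par s)) e (cross-↭ˡ s p)) (sym (par-++ v s)))

xor-cancelʳ : ∀ a b c → a xor c ≡ b xor c → a ≡ b
xor-cancelʳ true  true  c     e = refl
xor-cancelʳ false false c     e = refl
xor-cancelʳ true  false true  ()
xor-cancelʳ true  false false ()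
xor-cancelʳ false true  true  ()
xor-cancelʳ false true  false ()

-- Removing the suffix removes equally many inversions modulo 2 on both sides. This lets a tour of
-- the shorter words account for every word of a coset.
~-cancelʳ : ∀ {u v} s → u ++ s ~ v ++ s → u ~ v
~-cancelʳ {u} {v} s (p , e) = q ,
  xor-cancelʳ (par u) (par v) (cross v s xor par s)
    (trans (cong (λ b → par u xor (b xor par s)) (sym (cross-↭ˡ s q)))
      (trans (sym (par-++ u s)) (trans e (par-++ v s))))
  where
  q : u ↭ v
  q = ↭-cancelˡ s (↭-trans (++-comm s u) (↭-trans p (++-comm v s)))

odd : ℕ → Bool
odd zero    = false
odd (suc n) = not (odd n)

-- Carrying `x` to the front exchanges it with each of the `length as` letters before it.
par-shift : ∀ as x bs → Unique (as ++ x ∷ bs) → par (as ++ x ∷ bs) ≡ odd (length as) xor par (x ∷ as ++ bs)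
par-shift []       x bs u = refl
par-shift (a ∷ as) x bs (a≢ ∷ u) = trans
  (cong₂ _xor_ (below-↭ a (shift x as bs)) (par-shift as x bs u))
  (trans
    (solve 3 (λ p q r → p :+ (q :+ r) := q :+ (p :+ r)) refl
      (below a (x ∷ as ++ bs)) (odd (length as)) (par (x ∷ as ++ bs)))
    (trans (cong (odd (length as) xor_) (par-swap (as ++ bs) (λ x≡a → All.lookup a≢ (∈-++⁺ʳ as (here refl)) (sym x≡a))))
      (solve 2 (λ p q → p :+ (con true :+ q) := (con true :+ p) :+ q) refl
        (odd (length as)) (par (x ∷ a ∷ as ++ bs)))))

-- The jump τ_k passes `k - 1` letters, so the odd `k ≥ 3` correspond to these numbers.
data EvenPos : ℕ → Set where
  two  : EvenPos 2
  more : ∀ {k} → EvenPos k → EvenPos (2 + k)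

evenPos-odd : ∀ {k} → EvenPos k → odd k ≡ false
evenPos-odd two      = refl
evenPos-odd (more e) = trans (not-involutive _) (evenPos-odd e)

~-shift : ∀ s as x bs → Unique (s ++ as ++ x ∷ bs) → EvenPos (length as) →
  s ++ as ++ x ∷ bs ~ s ++ x ∷ as ++ bs
~-shift s as x bs u e = ~-++ˡ s (shift x as bs ,
  trans (par-shift as x bs (unique-suffix s u)) (cong (_xor par (x ∷ as ++ bs)) (evenPos-odd e)))
  where
  unique-suffix : ∀ r {ys : Word} → Unique (r ++ ys) → Unique ys
  unique-suffix []      u = u
  unique-suffix (_ ∷ r) u = unique-suffix r (unique-tail u)

-- Paths and jumps

-- The list holds all vertices including both end points, so concatenating two paths takes exactly
-- one joining edge.
data Path {A : Set} (R : A → A → Set) : A → List A → A → Set where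
  end : ∀ {a} → Path R a (a ∷ []) a
  _∷_ : ∀ {a b bs c} → R a b → Path R b bs c → Path R a (a ∷ bs) c

data Step {A : Set} (a b : A) : List A → Set where
  here  : ∀ {xs} → Step a b (a ∷ b ∷ xs)
  there : ∀ {x xs} → Step a b xs → Step a b (x ∷ xs)

module _ {A : Set} {R : A → A → Set} where

  path-++ : ∀ {a b c d xs ys} → Path R a xs b → R b c → Path R c ys d → Path R a (xs ++ ys) d
  path-++ end     r q = r ∷ q
  path-++ (s ∷ p) r q = s ∷ path-++ p r q

  path-head : ∀ {a b xs} → Path R a xs b → a ∈ xs
  path-head end     = here refl
  path-head (_ ∷ _) = here refl

  path-first : ∀ {a b x xs} → Path R a (x ∷ xs) b → x ≡ a
  path-first end     = refl
  path-first (_ ∷ _) = refl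

  step-first : ∀ {a b c xs} → Path R b xs c → Step a b (a ∷ xs)
  step-first end     = here
  step-first (_ ∷ _) = here

  path-last : ∀ {a b xs} → Path R a xs b → b ∈ xs
  path-last end     = here refl
  path-last (_ ∷ p) = there (path-last p)

  path-step : ∀ {a b u v xs} → Path R a xs b → Step u v xs → R u v
  path-step (r ∷ end)   here      = r
  path-step (r ∷ _ ∷ _) here      = r
  path-step end         (there ())
  path-step (_ ∷ p)     (there s) = path-step p s

  path-cut : ∀ {a b u v xs} → Path R a xs b → Step u v xs →
    ∃₂ λ ys zs → xs ≡ ys ++ zs × Path R a ys u × Path R v zs b
  path-cut (r ∷ end)   here       = _ , _ , refl , end , end
  path-cut (r ∷ q ∷ p) here       = _ , _ , refl , end , q ∷ p
  path-cut (r ∷ p)     (there s) with path-cut p s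
  ... | _ , _ , refl , q , q′ = _ , _ , refl , r ∷ q , q′

  -- Used to see which steps survive when something is inserted between two paths: only the joining
  -- one can be lost.
  step-split : ∀ {a b c d u v xs ys} → Path R a xs b → Path R c ys d → Step u v (xs ++ ys) →
    Step u v xs ⊎ Step u v ys ⊎ (u ≡ b × v ≡ c)
  step-split end end     here = inj₂ (inj₂ (refl , refl))
  step-split end (_ ∷ _) here = inj₂ (inj₂ (refl , refl))
  step-split end q (there s)  = inj₂ (inj₁ s)
  step-split (r ∷ end)   q here = inj₁ here
  step-split (r ∷ _ ∷ _) q here = inj₁ here
  step-split (r ∷ p) q (there s) with step-split p q s
  ... | inj₁ s′ = inj₁ (there s′)
  ... | inj₂ s′ = inj₂ s′

  module _ {P : A → Set} (P? : ∀ a → Dec (P a)) where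

    -- Follow the path until it first leaves `P`, which happens no later than at `c`.
    crossing-from : ∀ {a b c xs} → Path R a xs b → P a → c ∈ xs → ¬ P c →
      ∃₂ λ u v → Step u v xs × P u × ¬ P v
    crossing-from p pa (here refl) ¬pc = contradiction (subst P (sym (path-first p)) pa) ¬pc
    crossing-from end pa (there ()) ¬pc
    crossing-from (_∷_ {b = b} r p) pa (there c∈) ¬pc with P? b
    ... | no ¬pb = _ , _ , step-first p , pa , ¬pb
    ... | yes pb with crossing-from p pb c∈ ¬pc
    ... | u , v , s , pu , ¬pv = u , v , there s , pu , ¬pv

    crossing-to : ∀ {a b c xs} → Path R a xs b → ¬ P b → c ∈ xs → P c →
      ∃₂ λ u v → Step u v xs × P u × ¬ P v
    crossing-to p ¬pb (here refl) pc = crossing-from p (subst P (path-first p) pc) (path-last p) ¬pb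
    crossing-to end ¬pb (there ()) pc
    crossing-to (r ∷ p) ¬pb (there c∈) pc with crossing-to p ¬pb c∈ pc
    ... | u , v , s , pu , ¬pv = u , v , there s , pu , ¬pv

path-map : ∀ {A B : Set} {R : A → A → Set} {S : B → B → Set} (f : A → B) →
  (∀ {a b} → R a b → S (f a) (f b)) → ∀ {a b xs} → Path R a xs b → Path S (f a) (map f xs) (f b)
path-map f h end     = end
path-map f h (r ∷ p) = h r ∷ path-map f h p

step-map : ∀ {A B : Set} (f : A → B) {u v xs} → Step u v xs → Step (f u) (f v) (map f xs)
step-map f here      = here
step-map f (there s) = there (step-map f s)

step-++ˡ : ∀ {A : Set} {u v : A} {xs} ys → Step u v xs → Step u v (xs ++ ys)
step-++ˡ ys here      = here
step-++ˡ ys (there s) = there (step-++ˡ ys s)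

step-++ʳ : ∀ {A : Set} {u v : A} xs {ys} → Step u v ys → Step u v (xs ++ ys)
step-++ʳ []       s = s
step-++ʳ (_ ∷ xs) s = there (step-++ʳ xs s)

step-source : ∀ {A : Set} {u v : A} {xs} → Step u v xs → u ∈ xs
step-source here      = here refl
step-source (there s) = there (step-source s)

-- An edge of the Cayley graph in one-line notation: with `k = length pre + 1`, multiplying by τ_k
-- on the right moves the `k`-th letter to the front.
record Jump (u v : Word) : Set where
  constructor jump
  field
    pre    : Word
    letter : ℕ
    post   : Word
    even   : EvenPos (length pre)
    source : u ≡ pre ++ letter ∷ post
    target : v ≡ letter ∷ pre ++ post

jump-map : ∀ (g : ℕ → ℕ) {u v} → Jump u v → Jump (map g u) (map g v)
jump-map g (jump as x bs e refl refl) =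
  jump (map g as) (g x) (map g bs) (subst EvenPos (sym (length-map g as)) e)
    (map-++ g as (x ∷ bs)) (cong (g x ∷_) (map-++ g as bs))

jump-++ : ∀ s {u v} → Jump u v → Jump (u ++ s) (v ++ s)
jump-++ s (jump as x bs e refl refl) =
  jump as x (bs ++ s) e (++-assoc as (x ∷ bs) s) (cong (x ∷_) (++-assoc as bs s))

-- Hamiltonian tours of the even rearrangements of a word

-- The cycle is kept opened at its edge from `t` to `s`, since splicing will remove that edge.
-- Evenness is measured relative to `t`, so the same notion serves for the shorter words of any
-- coset.
record Tour (t s : Word) (N : List Word) : Set where
  constructor tour
  field
    path     : Path Jump s N t
    closing  : Jump t s
    unique   : Unique N
    sound    : ∀ {w} → w ∈ N → t ~ w
    complete : ∀ {w} → t ~ w → w ∈ N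

rotate : ∀ {t s u v N} → Tour t s N → Step u v N →
  ∃ λ N′ → Tour u v N′ × N ↭ N′
rotate (tour path closing unique sound complete) st with path-cut path st
... | ys , zs , refl , p , q = zs ++ ys ,
  tour (path-++ q closing p) (path-step path st) (Unique-resp-↭ r unique)
    (λ w∈ → ~-trans (~-sym u~) (sound (∈-resp-↭ (↭-sym r) w∈)))
    (λ u~w → ∈-resp-↭ r (complete (~-trans u~ u~w))) , r
  where
  r = ++-comm ys zs
  u~ = sound (step-source st)

-- A rule on letters, thus a left multiplication, which commutes with jumps. Outside `t` it is the
-- identity.
assign : Word → Word → ℕ → ℕ
assign (a ∷ t) (b ∷ t′) x with x ≟ a
... | yes _ = b
... | no  _ = assign t t′ x
assign _ _ x = x

map-cong∈ : ∀ {A B : Set} {f g : A → B} xs → (∀ {x} → x ∈ xs → f x ≡ g x) → map f xs ≡ map g xs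
map-cong∈ []       h = refl
map-cong∈ (x ∷ xs) h = cong₂ _∷_ (h (here refl)) (map-cong∈ xs (h ∘ there))

map-id∈ : ∀ {A : Set} (f : A → A) xs → map f xs ≡ xs → ∀ {x} → x ∈ xs → f x ≡ x
map-id∈ f (x ∷ xs) eq (here refl) = proj₁ (∷-injective eq)
map-id∈ f (x ∷ xs) eq (there x∈)  = map-id∈ f xs (proj₂ (∷-injective eq)) x∈

map-assign : ∀ t t′ → Unique t → length t ≡ length t′ → map (assign t t′) t ≡ t′
map-assign []      []        u len = refl
map-assign (a ∷ t) (b ∷ t′) u len = cong₂ _∷_ first
  (trans (map-cong∈ t rest) (map-assign t t′ (unique-tail u) (suc-injective len)))
  where
  first : assign (a ∷ t) (b ∷ t′) a ≡ b
  first with a ≟ a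
  ... | yes _ = refl
  ... | no ¬p = contradiction refl ¬p
  rest : ∀ {x} → x ∈ t → assign (a ∷ t) (b ∷ t′) x ≡ assign t t′ x
  rest {x} x∈ with x ≟ a
  ... | yes refl = contradiction x∈ (unique-head u)
  ... | no _ = refl

~-map : ∀ (g : ℕ → ℕ) {t w} → Unique t → Unique (map g t) → t ~ w → map g t ~ map g w
~-map g {t} {w} u ug (p , e) = map⁺ g p ,
  xor-eq (trans (sym (relabel id g p (subst Unique (sym (map-id t)) u) ug))
    (trans (cong₂ (λ a b → par a xor par b) (map-id t) (map-id w)) (trans (cong (_xor par w) e) (xor-same (par w)))))
  where
  xor-eq : ∀ {a b} → a xor b ≡ false → a ≡ b
  xor-eq {true}  {true}  _ = refl
  xor-eq {false} {false} _ = refl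

-- Jumps act on positions and relabelling on letters, so the two commute; `~-map` keeps evenness,
-- and the inverse assignment `h` gives distinctness and completeness.
transport : ∀ {t s N} t′ → Tour t s N → Unique t → Unique t′ → length t ≡ length t′ →
  let g = assign t t′ in Tour t′ (map g s) (map (map g) N)
transport {t} {s} {N} t′ (tour path closing unique sound complete) u u′ len = tour
  (subst (Path Jump _ _) gt (path-map (map g) (jump-map g) path))
  (subst (λ w → Jump w (map g s)) gt (jump-map g closing))
  (unique-map (map g) (map h) (λ w∈ → back (sound w∈)) unique)
  sound′ complete′
  where
  g = assign t t′
  h = assign t′ t
  gt : map g t ≡ t′
  gt = map-assign t t′ u len
  ht : map h t′ ≡ t
  ht = map-assign t′ t u′ (sym len)
  cancel : ∀ {t} (g h : ℕ → ℕ) → map h (map g t) ≡ t → ∀ {w} → t ~ w → map h (map g w) ≡ w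
  cancel {t} g h eq {w} t~w = trans (sym (map-∘ w)) (trans
    (map-cong∈ w (λ x∈ → map-id∈ (h ∘ g) t (trans (map-∘ t) eq) (∈-resp-↭ (↭-sym (perm t~w)) x∈))) (map-id w))
  back : ∀ {w} → t ~ w → map h (map g w) ≡ w
  back = cancel g h (trans (cong (map h) gt) ht)
  forth : ∀ {w} → t′ ~ w → map g (map h w) ≡ w
  forth = cancel h g (trans (cong (map g) ht) gt)
  sound′ : ∀ {w} → w ∈ map (map g) N → t′ ~ w
  sound′ w∈ with ∈-map⁻ (map g) w∈
  ... | v , v∈ , refl = subst (_~ map g v) gt (~-map g u (subst Unique (sym gt) u′) (sound v∈))
  complete′ : ∀ {w} → t′ ~ w → w ∈ map (map g) N
  complete′ {w} t′~w = subst (_∈ map (map g) N) (forth t′~w) (∈-map⁺ (map g)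
    (complete (subst (_~ map h w) ht (~-map h u′ (subst Unique (sym ht) u) t′~w))))

-- A tour leaves the words with a given last letter, which only a jump of the last letter can do.

Ends : ℕ → Word → Set
Ends x w = ∃ λ v → w ≡ v ∷ʳ x

ends? : ∀ x w → Dec (Ends x w)
ends? x w with initLast w
... | []      = no λ { ([] , ()) ; (_ ∷ _ , ()) }
... | v ∷ʳ′ y = map′ (λ { refl → v , refl }) (λ { (v′ , eq) → proj₂ (∷ʳ-injective v v′ eq) }) (y ≟ x)

-- By the length there are two further letters, and exchanging them corrects the parity if the first
-- arrangement has the wrong one.
ending-in : ∀ {t x} → Unique t → 3 ≤ length t → x ∈ t →
  (∃ λ v → t ~ v ∷ʳ x) × ∃ λ y → y ∈ t × y ≢ x
ending-in {t} {x} u len x∈ with extract x∈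
... | [] , p = contradiction (subst (3 ≤_) (↭-length p) len) λ { (s≤s ()) }
... | _ ∷ [] , p = contradiction (subst (3 ≤_) (↭-length p) len) λ { (s≤s (s≤s ())) }
... | a ∷ b ∷ r , p = arrange , a , ∈-resp-↭ (↭-sym p) (there (here refl)) ,
  λ { refl → unique-head u′ (here refl) }
  where
  u′ : Unique (x ∷ a ∷ b ∷ r)
  u′ = Unique-resp-↭ p u
  q : t ↭ (a ∷ b ∷ r) ∷ʳ x
  q = ↭-trans p (++-comm [ x ] (a ∷ b ∷ r))
  arrange : ∃ λ v → t ~ v ∷ʳ x
  arrange with par t Bool.≟ par ((a ∷ b ∷ r) ∷ʳ x)
  ... | yes e = a ∷ b ∷ r , (q , e)
  ... | no ¬e = b ∷ a ∷ r , (↭-trans q (swap a b refl) ,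
    trans (¬-not ¬e) (sym (par-swap {a} {b} (r ∷ʳ x) (λ { refl → unique-head (unique-tail u′) (here refl) }))))

last-jump : ∀ {u v W x} → Jump u v → u ≡ W ∷ʳ x → ¬ Ends x v → v ≡ x ∷ W
last-jump {W = W} (jump as a bs e src tgt) eq ¬ends with initLast bs
... | [] with ∷ʳ-injective as W (trans (sym src) eq)
... | refl , refl = trans tgt (cong (a ∷_) (++-identityʳ as))
last-jump {W = W} (jump as a bs e src tgt) eq ¬ends | bs′ ∷ʳ′ b
  with ∷ʳ-injective (as ++ a ∷ bs′) W (trans (++-assoc as (a ∷ bs′) [ b ]) (trans (sym src) eq))
... | _ , refl = contradiction (a ∷ as ++ bs′ , trans tgt (cong (a ∷_) (sym (++-assoc as bs′ [ b ])))) ¬ends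

-- If only `t` ends in `x`, the closing jump is the exit. If `t` does not, the path visits a word
-- ending in `x` and must leave such words before reaching `t`. If both `t` and `s` do, it must
-- leave them to visit a word ending in another letter.
exit : ∀ {t s N x} → Tour t s N → Unique t → 3 ≤ length t → x ∈ t →
  (∃ λ W → Step (W ∷ʳ x) (x ∷ W) N) ⊎ (∃ λ W → t ≡ W ∷ʳ x × s ≡ x ∷ W)
exit {t} {s} {N} {x} (tour path closing unique sound complete) u len x∈ with ending-in u len x∈
... | (v , t~v) , y , y∈ , y≢x = choose (ends? x t) (ends? x s)
  where
  inside : (∃₂ λ u v → Step u v N × Ends x u × ¬ Ends x v) → ∃ λ W → Step (W ∷ʳ x) (x ∷ W) N
  inside (_ , _ , st , (W , refl) , ¬v) = W , subst (λ w → Step _ w N) (last-jump (path-step path st) refl ¬v) st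
  choose : Dec (Ends x t) → Dec (Ends x s) → (∃ λ W → Step (W ∷ʳ x) (x ∷ W) N) ⊎ (∃ λ W → t ≡ W ∷ʳ x × s ≡ x ∷ W)
  choose (yes (W , eq)) (no ¬s)  = inj₂ (W , eq , last-jump closing eq ¬s)
  choose (no ¬t)        _        = inj₁ (inside (crossing-to (ends? x) path ¬t (complete t~v) (v , refl)))
  choose (yes _)        (yes es) =
    let (v′ , t~v′) , _ = ending-in u len y∈ in
    inj₁ (inside (crossing-from (ends? x) path es (complete t~v′) (λ { (v″ , eq) → y≢x (proj₂ (∷ʳ-injective v′ v″ eq)) })))

-- Tours with a prescribed closing jump

∷ʳ²-injective : ∀ {A : Set} (U V : List A) {y z y′ z′} → U ++ y ∷ z ∷ [] ≡ V ++ y′ ∷ z′ ∷ [] →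
  U ≡ V × y ≡ y′ × z ≡ z′
∷ʳ²-injective U V {y} {z} {y′} {z′} eq
  with ∷ʳ-injective (U ∷ʳ y) (V ∷ʳ y′) (trans (++-assoc U _ _) (trans eq (sym (++-assoc V _ _))))
... | eq′ , refl with ∷ʳ-injective U V eq′
... | refl , refl = refl , refl , refl

∷ʳ³-injective : ∀ {A : Set} (U V : List A) {x y z x′ y′ z′} → U ++ x ∷ y ∷ z ∷ [] ≡ V ++ x′ ∷ y′ ∷ z′ ∷ [] →
  U ≡ V × x ≡ x′ × y ≡ y′ × z ≡ z′
∷ʳ³-injective U V {x} {y} {z} {x′} eq
  with ∷ʳ²-injective (U ∷ʳ x) (V ∷ʳ x′) (trans (++-assoc U _ _) (trans eq (sym (++-assoc V _ _))))
... | eq′ , refl , refl with ∷ʳ-injective U V eq′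
... | refl , refl = refl , refl , refl , refl

-- What the induction needs to know about `m` letters: the closing jump may be chosen as τ_m, or as
-- τ_(m-2), at any prescribed word of distinct letters.
record Tours (m ℓ : ℕ) : Set where
  field
    last-tour  : ∀ W x → Unique (W ∷ʳ x) → length (W ∷ʳ x) ≡ m →
      ∃ λ N → Tour (W ∷ʳ x) (x ∷ W) N × length N ≡ ℓ
    third-tour : ∀ W x y z → Unique (W ++ x ∷ y ∷ z ∷ []) → length (W ++ x ∷ y ∷ z ∷ []) ≡ m →
      ∃ λ N → Tour (W ++ x ∷ y ∷ z ∷ []) (x ∷ W ++ y ∷ z ∷ []) N × length N ≡ ℓ

-- A single τ_(m-2) step is enough, since a τ_m step exists by `exit`. Rotation makes the chosen
-- step the closing one, and relabelling carries its source to the prescribed word.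
tours : ∀ {t s N W x y z} → Tour t s N → Unique t → 3 ≤ length t →
  Step (W ++ x ∷ y ∷ z ∷ []) (x ∷ W ++ y ∷ z ∷ []) N → Tours (length t) (length N)
tours {t} {s} {N} {U} {a} {b} {c} T u len st = record { last-tour = last-tour ; third-tour = third-tour }
  where
  move : ∀ {t₁ s₁} N₁ → Tour t₁ s₁ N₁ → N ↭ N₁ → ∀ t₂ s₂ → Unique t₂ → length t₂ ≡ length t → t ~ t₁ →
    (∀ g → map g t₁ ≡ t₂ → map g s₁ ≡ s₂) → ∃ λ N → Tour t₂ s₂ N × length N ≡ _
  move {t₁} N₁ T₁ p t₂ s₂ u₂ len₂ t~t₁ follow =
    _ , subst (λ s → Tour t₂ s _) (follow (assign t₁ t₂) (map-assign t₁ t₂ u₁ len₁)) (transport t₂ T₁ u₁ u₂ len₁) ,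
    trans (length-map _ N₁) (sym (↭-length p))
    where
    u₁ = ~-unique t~t₁ u
    len₁ = trans (sym (↭-length (perm t~t₁))) (sym len₂)
  last-follow : ∀ {V x W y} g → map g (V ∷ʳ x) ≡ W ∷ʳ y → map g (x ∷ V) ≡ y ∷ W
  last-follow {V} {x} {W} g eq with ∷ʳ-injective (map g V) W (trans (sym (map-++ g V [ x ])) eq)
  ... | refl , refl = refl
  third-follow : ∀ {V x y z W x′ y′ z′} g → map g (V ++ x ∷ y ∷ z ∷ []) ≡ W ++ x′ ∷ y′ ∷ z′ ∷ [] →
    map g (x ∷ V ++ y ∷ z ∷ []) ≡ x′ ∷ W ++ y′ ∷ z′ ∷ []
  third-follow {V} {x} {y} {z} {W} g eq
    with ∷ʳ³-injective (map g V) W (trans (sym (map-++ g V (x ∷ y ∷ z ∷ []))) eq)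
  ... | refl , refl , refl , refl = cong (g x ∷_) (map-++ g V (y ∷ z ∷ []))
  some-letter : ∀ t → 3 ≤ length t → ∃ λ x → x ∈ t
  some-letter (x ∷ _) _ = x , here refl
  last-tour : ∀ W x → Unique (W ∷ʳ x) → length (W ∷ʳ x) ≡ length t →
    ∃ λ N′ → Tour (W ∷ʳ x) (x ∷ W) N′ × length N′ ≡ length N
  last-tour W x u′ len′ with exit T u len (proj₂ (some-letter t len))
  ... | inj₂ (V , eq , eq′) =
    move N (subst₂ (λ a b → Tour a b N) eq eq′ T) ↭-refl _ _ u′ len′ (~-reflexive eq) last-follow
  ... | inj₁ (V , st′) with rotate T st′
  ... | N₁ , T₁ , p = move N₁ T₁ p _ _ u′ len′ (Tour.sound T (step-source st′)) last-follow
  third-tour : ∀ W x y z → Unique (W ++ x ∷ y ∷ z ∷ []) → length (W ++ x ∷ y ∷ z ∷ []) ≡ length t →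
    ∃ λ N′ → Tour (W ++ x ∷ y ∷ z ∷ []) (x ∷ W ++ y ∷ z ∷ []) N′ × length N′ ≡ length N
  third-tour W x y z u′ len′ with rotate T st
  ... | N₁ , T₁ , p = move N₁ T₁ p _ _ u′ len′ (Tour.sound T (step-source st)) third-follow

Pair : Set
Pair = ℕ × ℕ

-- Merging the cosets of the words with given last two letters

-- Here `n = 2 + m`, a coset is named by its last two letters, and `EvenPos (suc m)` makes τ_n,
-- which passes `m + 1` letters, an admissible jump.
module Merge (t : Word) (u : Unique t) {m ℓ : ℕ} (3≤m : 3 ≤ m) (len : length t ≡ 2 + m)
  (m-odd : EvenPos (suc m)) (T : Tours m ℓ) where

  open Tours T

  record Cover (L : List Pair) (N : List Word) : Set where
    constructor cover
    field
      unique   : Unique N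
      sound    : ∀ {w} → w ∈ N → t ~ w × ∃ λ V → ∃₂ λ y z → w ≡ V ++ y ∷ z ∷ [] × (y , z) ∈ L
      complete : ∀ {V y z} → (y , z) ∈ L → t ~ V ++ y ∷ z ∷ [] → V ++ y ∷ z ∷ [] ∈ N
      size     : length N ≡ length L * ℓ

  cover-++ : ∀ {L L′ N N′ N″} → Cover L N → Cover L′ N′ → (∀ {q} → q ∈ L → q ∉ L′) →
    N″ ↭ N ++ N′ → Cover (L ++ L′) N″
  cover-++ {L} {L′} {N} {N′} {N″} C C′ disjoint p = cover
    (Unique-resp-↭ (↭-sym p) (Unique.++⁺ C.unique C′.unique apart)) sound complete
    (trans (↭-length p) (trans (length-++ N) (trans (cong₂ _+_ C.size C′.size)
      (trans (sym (*-distribʳ-+ ℓ (length L) (length L′))) (cong (_* ℓ) (sym (length-++ L)))))))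
    where
    module C = Cover C
    module C′ = Cover C′
    apart : ∀ {w} → ¬ (w ∈ N × w ∈ N′)
    apart (w∈ , w∈′) with C.sound w∈ | C′.sound w∈′
    ... | _ , V , y , z , refl , q | _ , V′ , y′ , z′ , eq , q′ with ∷ʳ²-injective V V′ eq
    ... | refl , refl , refl = disjoint q q′
    sound : ∀ {w} → w ∈ N″ → t ~ w × ∃ λ V → ∃₂ λ y z → w ≡ V ++ y ∷ z ∷ [] × (y , z) ∈ L ++ L′
    sound w∈ with ∈-++⁻ N (∈-resp-↭ p w∈)
    ... | inj₁ w∈N  = let e , V , y , z , eq , q = C.sound w∈N in e , V , y , z , eq , ∈-++⁺ˡ q
    ... | inj₂ w∈N′ = let e , V , y , z , eq , q = C′.sound w∈N′ in e , V , y , z , eq , ∈-++⁺ʳ L q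
    complete : ∀ {V y z} → (y , z) ∈ L ++ L′ → t ~ V ++ y ∷ z ∷ [] → V ++ y ∷ z ∷ [] ∈ N″
    complete q e with ∈-++⁻ L q
    ... | inj₁ q∈L  = ∈-resp-↭ (↭-sym p) (∈-++⁺ˡ (C.complete q∈L e))
    ... | inj₂ q∈L′ = ∈-resp-↭ (↭-sym p) (∈-++⁺ʳ N (C′.complete q∈L′ e))

  -- A jump τ_(n-2) inside the coset `(y , z)`: the kind of step that a triangle replaces by τ_n.
  Exit : ℕ → ℕ → ℕ → List Word → Set
  Exit x y z N = ∃ λ W → Step (W ++ x ∷ y ∷ z ∷ []) (x ∷ W ++ y ∷ z ∷ []) N

  -- A coset whose tour has been opened at the jump from `p` to `s`. If that jump was itself the
  -- exit through `x`, this exit may be lost, which the second alternative of `exits` records.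
  record Block (y z : ℕ) (p s : Word) : Set where
    field
      nodes : List Word
      path  : Path Jump s nodes p
      cov   : Cover [ y , z ] nodes
      exits : ∀ {x} → x ∈ t → x ≢ y → x ≢ z → Exit x y z nodes ⊎
        (∃ λ W → p ≡ W ++ x ∷ y ∷ z ∷ [] × s ≡ x ∷ W ++ y ∷ z ∷ [])

  length-init : ∀ V y z → t ~ V ++ y ∷ z ∷ [] → length V ≡ m
  length-init V y z e = +-cancelʳ-≡ 2 (length V) m
    (trans (sym (length-++ V)) (trans (sym (↭-length (perm e))) (trans len (+-comm 2 m))))

  block : ∀ V s N y z → Tour V s N → length N ≡ ℓ → t ~ V ++ y ∷ z ∷ [] → Block y z (V ++ y ∷ z ∷ []) (s ++ y ∷ z ∷ [])
  block V s N y z (tour path closing unique sound complete) size e = record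
    { nodes = map app N
    ; path  = path-map app (jump-++ _) path
    ; cov   = cover (Unique.map⁺ (λ {v} {w} eq → ++-cancelʳ _ v w eq) unique) sound′ complete′
        (trans (length-map app N) (trans size (sym (+-identityʳ ℓ))))
    ; exits = exits
    }
    where
    app : Word → Word
    app w = w ++ y ∷ z ∷ []
    uV : Unique V
    uV = unique-prefix V (~-unique e u)
    sound′ : ∀ {w} → w ∈ map app N → t ~ w × ∃ λ W → ∃₂ λ y′ z′ → w ≡ W ++ y′ ∷ z′ ∷ [] × (y′ , z′) ∈ [ y , z ]
    sound′ w∈ with ∈-map⁻ app w∈
    ... | v , v∈ , refl = ~-trans e (~-++ʳ _ (sound v∈)) , v , y , z , refl , here refl
    complete′ : ∀ {W y′ z′} → (y′ , z′) ∈ [ y , z ] → t ~ W ++ y′ ∷ z′ ∷ [] → W ++ y′ ∷ z′ ∷ [] ∈ map app N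
    complete′ (here refl) e′ = ∈-map⁺ app (complete (~-cancelʳ _ (~-trans (~-sym e) e′)))
    exits : ∀ {x} → x ∈ t → x ≢ y → x ≢ z → Exit x y z (map app N) ⊎
        (∃ λ W → app V ≡ W ++ x ∷ y ∷ z ∷ [] × app s ≡ x ∷ W ++ y ∷ z ∷ [])
    exits {x} x∈ x≢y x≢z with ∈-++⁻ V (∈-resp-↭ (perm e) x∈)
    ... | inj₂ (here x≡y) = contradiction x≡y x≢y
    ... | inj₂ (there (here x≡z)) = contradiction x≡z x≢z
    ... | inj₁ x∈V with exit (tour path closing unique sound complete) uV (subst (3 ≤_) (sym (length-init V y z e)) 3≤m) x∈V
    ... | inj₁ (W , st) = inj₁ (W , subst (λ w → Step w (x ∷ W ++ y ∷ z ∷ []) (map app N)) (++-assoc W [ x ] _) (step-map app st))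
    ... | inj₂ (W , refl , refl) = inj₂ (W , ++-assoc W [ x ] _ , refl)

  last-block : ∀ W x y z → t ~ W ++ x ∷ y ∷ z ∷ [] → Block y z (W ++ x ∷ y ∷ z ∷ []) (x ∷ W ++ y ∷ z ∷ [])
  last-block W x y z e = subst (λ w → Block y z w (x ∷ W ++ y ∷ z ∷ [])) (++-assoc W [ x ] _) (block (W ∷ʳ x) (x ∷ W) N y z T′ size e′)
    where
    e′ : t ~ (W ∷ʳ x) ++ y ∷ z ∷ []
    e′ = ~-trans e (~-reflexive (sym (++-assoc W [ x ] _)))
    r = last-tour W x (unique-prefix (W ∷ʳ x) (~-unique e′ u)) (length-init _ y z e′)
    N = proj₁ r
    T′ = proj₁ (proj₂ r)
    size = proj₂ (proj₂ r)

  third-block : ∀ W a b x y z → t ~ W ++ a ∷ b ∷ x ∷ y ∷ z ∷ [] →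
    Block y z (W ++ a ∷ b ∷ x ∷ y ∷ z ∷ []) (a ∷ W ++ b ∷ x ∷ y ∷ z ∷ [])
  third-block W a b x y z e = subst₂ (Block y z) (++-assoc W (a ∷ b ∷ x ∷ []) _)
    (cong (a ∷_) (++-assoc W (b ∷ x ∷ []) _))
    (block (W ++ a ∷ b ∷ x ∷ []) (a ∷ W ++ b ∷ x ∷ []) N y z T′ size e′)
    where
    e′ : t ~ (W ++ a ∷ b ∷ x ∷ []) ++ y ∷ z ∷ []
    e′ = ~-trans e (~-reflexive (sym (++-assoc W (a ∷ b ∷ x ∷ []) _)))
    r = third-tour W a b x (unique-prefix _ (~-unique e′ u)) (length-init _ y z e′)
    N = proj₁ r
    T′ = proj₁ (proj₂ r)
    size = proj₂ (proj₂ r)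

  long-jump : ∀ W x y z → t ~ W ++ x ∷ y ∷ z ∷ [] → Jump (W ++ x ∷ y ∷ z ∷ []) (z ∷ W ++ x ∷ y ∷ [])
  long-jump W x y z e = jump (W ++ x ∷ y ∷ []) z [] (subst EvenPos (sym lenW) m-odd)
    (sym (++-assoc W (x ∷ y ∷ []) [ z ])) (cong (z ∷_) (sym (++-identityʳ _)))
    where
    lenW : length (W ++ x ∷ y ∷ []) ≡ suc m
    lenW = +-cancelʳ-≡ 1 _ (suc m) (trans (sym (length-++ (W ++ x ∷ y ∷ [])))
      (trans (cong length (++-assoc W (x ∷ y ∷ []) [ z ]))
      (trans (sym (↭-length (perm e))) (trans len (+-comm 1 (suc m))))))

  -- `avail` is the invariant that keeps further triangles possible. `spare` retains one τ_(n-2)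
  -- step to the end, where `tours` asks for it to prepare the next stage of the induction.
  record State (L : List Pair) : Set where
    constructor state
    field
      {start stop} : Word
      nodes   : List Word
      path    : Path Jump start nodes stop
      closing : Jump stop start
      cov     : Cover L nodes
      avail   : ∀ {x y z} → x ∈ t → x ≢ y → x ≢ z → (y , z) ∈ L → (z , x) ∉ L → (x , y) ∉ L → Exit x y z nodes
      spare   : ∃ λ x → ∃₂ λ y z → Exit x y z nodes

  exit-++ˡ : ∀ {x y z N} N′ → Exit x y z N → Exit x y z (N ++ N′)
  exit-++ˡ N′ (W , st) = W , step-++ˡ N′ st

  exit-++ʳ : ∀ {x y z} N {N′} → Exit x y z N′ → Exit x y z (N ++ N′)
  exit-++ʳ N (W , st) = W , step-++ʳ N st

  rotate-last : ∀ W x y z → t ~ W ++ x ∷ y ∷ z ∷ [] → t ~ W ++ z ∷ x ∷ y ∷ []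
  rotate-last W x y z e = ~-trans e (~-shift W (x ∷ y ∷ []) z [] (~-unique e u) two)

  nonempty : ∀ W {x y z} → t ~ W ++ x ∷ y ∷ z ∷ [] → ∃ λ w → w ∈ W
  nonempty (w ∷ _) e = w , here refl
  nonempty [] {x} {y} {z} e with length-init [ x ] y z e
  ... | refl = contradiction 3≤m λ { (s≤s ()) }

  -- The exit through x from the coset (y , z) is only ever used up by the triangle that adds
  -- (z , x) and (x , y).
  Available : List Pair → List Word → Set
  Available L N = ∀ {x y z} → x ∈ t → x ≢ y → x ≢ z → (y , z) ∈ L → (z , x) ∉ L → (x , y) ∉ L → Exit x y z N

  -- The jump `Wxyz → xWyz` is replaced by a detour: `Wxyz → zWxy`, through `(x , y)` to
  -- `Wzxy → yWzx`, through `(z , x)` to `Wyzx → xWyz`. The three arrows between cosets are τ_n, and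
  -- the new blocks are opened exactly where the detour enters and leaves them.
  module Triangle {L N₁ N₂ W x y z start stop}
    (p₁ : Path Jump start N₁ (W ++ x ∷ y ∷ z ∷ [])) (p₂ : Path Jump (x ∷ W ++ y ∷ z ∷ []) N₂ stop)
    (closing : Jump stop start) (cov : Cover L (N₁ ++ N₂)) (avail : Available L (N₁ ++ N₂))
    (e₁ : t ~ W ++ x ∷ y ∷ z ∷ []) (e₂ : t ~ W ++ z ∷ x ∷ y ∷ []) (e₃ : t ~ W ++ y ∷ z ∷ x ∷ [])
    (B₂ : Block x y (W ++ z ∷ x ∷ y ∷ []) (z ∷ W ++ x ∷ y ∷ []))
    (B₃ : Block z x (W ++ y ∷ z ∷ x ∷ []) (y ∷ W ++ z ∷ x ∷ []))
    (yz∈ : (y , z) ∈ L) (zx∉ : (z , x) ∉ L) (xy∉ : (x , y) ∉ L) (x≢z : x ≢ z) where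

    module B₂ = Block B₂
    module B₃ = Block B₃

    L′ : List Pair
    L′ = (x , y) ∷ (z , x) ∷ L

    D : List Word
    D = B₂.nodes ++ B₃.nodes

    disjoint : ∀ {q} → q ∈ [ x , y ] → q ∉ [ z , x ]
    disjoint (here refl) (here eq) = x≢z (proj₁ (,-injective eq))

    disjoint′ : ∀ {q} → q ∈ (x , y) ∷ (z , x) ∷ [] → q ∉ L
    disjoint′ (here refl) = xy∉
    disjoint′ (there (here refl)) = zx∉

    spare : ∀ {w} → w ∈ W → Exit w z x B₃.nodes
    spare {w} w∈ = choose (B₃.exits (∈-resp-↭ (↭-sym (perm e₁)) (∈-++⁺ˡ w∈)) (w≢ (there (there (here refl)))) (w≢ (here refl)))
      where
      w≢ : ∀ {v} → v ∈ x ∷ y ∷ z ∷ [] → w ≢ v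
      w≢ v∈ refl = unique-disjoint W (~-unique e₁ u) w∈ v∈
      choose : Exit w z x B₃.nodes ⊎ _ → Exit w z x B₃.nodes
      choose (inj₁ ex) = ex
      -- The jump removed in this coset carries `y`, whereas `w` lies in `W`.
      choose (inj₂ (V , eq , _)) =
        contradiction (sym (proj₁ (proj₂ (∷ʳ³-injective W V eq)))) (w≢ (there (here refl)))

    -- Three exits may disappear: through `z` from `(x , y)`, through `y` from `(z , x)` and through
    -- `x` from `(y , z)`. All belong to the triangle just added, whose pairs are now covered, so
    -- the premises of `Available` exclude them.
    avail′ : Available L′ (N₁ ++ D ++ N₂)
    avail′ {a} a∈ a≢b a≢c (here refl) ca∉ ab∉ = choose (B₂.exits a∈ a≢b a≢c)
      where
      choose : Exit a x y B₂.nodes ⊎ _ → Exit a x y (N₁ ++ D ++ N₂)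
      choose (inj₁ ex) = exit-++ʳ N₁ (exit-++ˡ N₂ (exit-++ˡ B₃.nodes ex))
      choose (inj₂ (V , eq , _)) = contradiction
        (subst (λ c → (y , c) ∈ L′) (proj₁ (proj₂ (∷ʳ³-injective W V eq))) (there (there yz∈))) ca∉
    avail′ {a} a∈ a≢b a≢c (there (here refl)) ca∉ ab∉ = choose (B₃.exits a∈ a≢b a≢c)
      where
      choose : Exit a z x B₃.nodes ⊎ _ → Exit a z x (N₁ ++ D ++ N₂)
      choose (inj₁ ex) = exit-++ʳ N₁ (exit-++ˡ N₂ (exit-++ʳ B₂.nodes ex))
      choose (inj₂ (V , eq , _)) = contradiction
        (subst (λ c → (x , c) ∈ L′) (proj₁ (proj₂ (∷ʳ³-injective W V eq))) (here refl)) ca∉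
    avail′ {a} {b} {c} a∈ a≢b a≢c (there (there bc∈)) ca∉ ab∉ =
      persist (avail a∈ a≢b a≢c bc∈ (λ ca∈ → ca∉ (there (there ca∈))) (λ ab∈ → ab∉ (there (there ab∈))))
      where
      choose : ∀ {V} → Step (V ++ a ∷ b ∷ c ∷ []) (a ∷ V ++ b ∷ c ∷ []) N₁ ⊎
        Step (V ++ a ∷ b ∷ c ∷ []) (a ∷ V ++ b ∷ c ∷ []) N₂ ⊎
        (V ++ a ∷ b ∷ c ∷ [] ≡ W ++ x ∷ y ∷ z ∷ [] × _) → Exit a b c (N₁ ++ D ++ N₂)
      choose (inj₁ st) = _ , step-++ˡ (D ++ N₂) st
      choose (inj₂ (inj₁ st)) = _ , step-++ʳ N₁ (step-++ʳ D st)
      choose {V} (inj₂ (inj₂ (eq , _))) =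
        let _ , a≡x , _ , c≡z = ∷ʳ³-injective V W eq in
        contradiction (subst₂ (λ c a → (c , a) ∈ L′) (sym c≡z) (sym a≡x) (there (here refl))) ca∉
      persist : Exit a b c (N₁ ++ N₂) → Exit a b c (N₁ ++ D ++ N₂)
      persist (V , st) = choose (step-split p₁ p₂ st)

    joined : State L′
    joined = state (N₁ ++ D ++ N₂)
      (path-++ p₁ (long-jump W x y z e₁)
        (path-++ (path-++ B₂.path (long-jump W z x y e₂) B₃.path) (long-jump W y z x e₃) p₂))
      closing
      (cover-++ (cover-++ B₂.cov B₃.cov disjoint ↭-refl) cov disjoint′ (shifts N₁ D))
      avail′
      (let w , w∈ = nonempty W e₁ in
        w , z , x , exit-++ʳ N₁ (exit-++ˡ N₂ (exit-++ʳ B₂.nodes (spare w∈))))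

  abstract

    grow : ∀ {L} x y z → State L → (y , z) ∈ L → (z , x) ∉ L → (x , y) ∉ L →
      x ∈ t → x ≢ y → x ≢ z → State ((x , y) ∷ (z , x) ∷ L)
    grow x y z (state nodes path closing cov avail _) yz∈ zx∉ xy∉ x∈ x≢y x≢z
      with avail x∈ x≢y x≢z yz∈ zx∉ xy∉
    ... | W , st with path-cut path st
    ... | N₁ , N₂ , refl , p₁ , p₂ = Triangle.joined p₁ p₂ closing cov avail e₁ e₂ e₃
      (last-block W z x y e₂) (last-block W y z x e₃) yz∈ zx∉ xy∉ x≢z
      where
      e₁ : t ~ W ++ x ∷ y ∷ z ∷ []
      e₁ = proj₁ (Cover.sound cov (step-source st))
      e₂ : t ~ W ++ z ∷ x ∷ y ∷ []
      e₂ = rotate-last W x y z e₁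
      e₃ : t ~ W ++ y ∷ z ∷ x ∷ []
      e₃ = rotate-last W z x y e₂

-- From six cosets to all pairs of last letters

open DecMembership (≡-dec _≟_ _≟_) using () renaming (_∈?_ to _∈²?_)

pair-count : ∀ m → 2 * suc m + suc m * m ≡ (2 + m) * suc m
pair-count m = trans (cong (2 * suc m +_) (*-comm (suc m) m)) (sym (*-distribʳ-+ (suc m) 2 m))

Full : ℕ → List Pair → Set
Full m L = (∀ {a b} → (a , b) ∈ L → a < m × b < m × a ≢ b) × (∀ {a b} → a < m → b < m → a ≢ b → (a , b) ∈ L)

-- The last two letters of the six words of the initial splice, in its order. An even number of
-- initial cosets makes the parity right: on five letters `20 = 6 + 2 * 7`.
ring : List Pair
ring = (3 , 4) ∷ (2 , 3) ∷ (1 , 2) ∷ (0 , 1) ∷ (2 , 0) ∷ (4 , 2) ∷ []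

-- The order is the one left by the seven triangles of `five`, newest first.
pairs₅ : List Pair
pairs₅ = (4 , 3) ∷ (0 , 4) ∷ (3 , 1) ∷ (0 , 3) ∷ (0 , 2) ∷ (1 , 0) ∷ (4 , 0) ∷ (1 , 4) ∷
  (2 , 1) ∷ (3 , 2) ∷ (4 , 1) ∷ (2 , 4) ∷ (3 , 0) ∷ (1 , 3) ∷ ring

full₅ : Full 5 pairs₅
full₅ = All.lookup (toWitness {a? = All.all? (λ { (a , b) → a <? 5 ×-dec b <? 5 ×-dec ¬? (a ≟ b) }) pairs₅} _) ,
  λ a<5 b<5 → toWitness {a? = allUpTo? (λ a → allUpTo? (λ b → ¬? (a ≟ b) →-dec ((a , b) ∈²? pairs₅)) 5) 5} _ a<5 b<5

-- Now `n = 5 + j` and the shorter words have `3 + j` letters. The letters 0 to 4 carry the initial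
-- splice, and `U` collects the others.
module Growth (j : ℕ) {ℓ : ℕ} (m-odd : EvenPos (4 + j)) (T : Tours (3 + j) ℓ) where

  U t : Word
  U = applyUpTo (5 +_) j
  t = U ++ 0 ∷ 1 ∷ 2 ∷ 3 ∷ 4 ∷ []

  U-≥5 : ∀ {x} → x ∈ U → 5 ≤ x
  U-≥5 x∈ with ∈-applyUpTo⁻ (5 +_) x∈
  ... | i , _ , refl = m≤m+n 5 i

  length-t : length t ≡ 5 + j
  length-t = trans (length-++ U) (trans (+-comm _ 5) (cong (5 +_) (length-applyUpTo (5 +_) j)))

  unique-t : Unique t
  unique-t = Unique.++⁺ (Unique.applyUpTo⁺₁ (5 +_) j (λ i<k _ eq → <⇒≢ i<k (+-cancelˡ-≡ 5 _ _ eq)))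
    (Unique.upTo⁺ 5) (λ { (x∈ , x∈′) → disjoint x∈ x∈′ })
    where
    disjoint : ∀ {x} → x ∈ U → x ∉ upTo 5
    disjoint x∈ x∈′ with ∈-applyUpTo⁻ id x∈′
    ... | i , i<5 , refl = <⇒≱ i<5 (U-≥5 x∈)

  <⇒∈-t : ∀ {x} → x < 5 + j → x ∈ t
  <⇒∈-t {x} x< with x <? 5
  ... | yes x<5 = ∈-++⁺ʳ U (∈-applyUpTo⁺ id x<5)
  ... | no x≮5 with m≤n⇒∃[o]m+o≡n (≮⇒≥ x≮5)
  ... | i , refl = ∈-++⁺ˡ (∈-applyUpTo⁺ (5 +_) (+-cancelˡ-< 5 i j x<))

  ∈-t⇒< : ∀ {x} → x ∈ t → x < 5 + j
  ∈-t⇒< x∈ with ∈-++⁻ U x∈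
  ... | inj₁ x∈U with ∈-applyUpTo⁻ (5 +_) x∈U
  ... | i , i<j , refl = +-monoʳ-< 5 i<j
  ∈-t⇒< x∈ | inj₂ x∈5 with ∈-applyUpTo⁻ id x∈5
  ... | i , i<5 , refl = ≤-trans i<5 (m≤m+n 5 j)

  open Merge t unique-t (s≤s (s≤s (s≤s z≤n))) length-t m-odd T

  regroup : ∀ W {a b : ℕ} {v} → W ++ a ∷ b ∷ v ≡ (W ++ a ∷ b ∷ []) ++ v
  regroup W = sym (++-assoc W _ _)

  long-jump₅ : ∀ W a b x y z → t ~ W ++ a ∷ b ∷ x ∷ y ∷ z ∷ [] →
    Jump (W ++ a ∷ b ∷ x ∷ y ∷ z ∷ []) (z ∷ W ++ a ∷ b ∷ x ∷ y ∷ [])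
  long-jump₅ W a b x y z e = subst₂ Jump (sym (regroup W)) (cong (z ∷_) (sym (regroup W)))
    (long-jump (W ++ a ∷ b ∷ []) x y z (~-trans e (~-reflexive (regroup W))))

  last-block₅ : ∀ W a b x y z → t ~ W ++ a ∷ b ∷ x ∷ y ∷ z ∷ [] →
    Block y z (W ++ a ∷ b ∷ x ∷ y ∷ z ∷ []) (x ∷ W ++ a ∷ b ∷ y ∷ z ∷ [])
  last-block₅ W a b x y z e = subst₂ (Block y z) (sym (regroup W)) (cong (x ∷_) (sym (regroup W)))
    (last-block (W ++ a ∷ b ∷ []) x y z (~-trans e (~-reflexive (regroup W))))

  third-letter : ∀ V W {a b x y z x′ y′ z′} → V ++ a ∷ b ∷ x ∷ y ∷ z ∷ [] ≡ W ++ x′ ∷ y′ ∷ z′ ∷ [] → x ≡ x′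
  third-letter V W eq = proj₁ (proj₂ (∷ʳ³-injective _ W (trans (sym (regroup V)) eq)))

  -- The block is opened at a τ_(n-4) jump, which brings `a` to the front, whereas an exit lost
  -- there would bring `x`, the third letter from the end.
  third-exits : ∀ {a b x y z} → a ≢ x →
    (B : Block y z (U ++ a ∷ b ∷ x ∷ y ∷ z ∷ []) (a ∷ U ++ b ∷ x ∷ y ∷ z ∷ [])) →
    ∀ {c} → c ∈ t → c ≢ y → c ≢ z → Exit c y z (Block.nodes B)
  third-exits a≢x B c∈ c≢y c≢z with Block.exits B c∈ c≢y c≢z
  ... | inj₁ ex = ex
  ... | inj₂ (W , eq , eq′) = contradiction (trans (proj₁ (∷-injective eq′)) (sym (third-letter U W eq))) a≢x

  -- Opening a coset at a τ_(n-2) jump can lose only the exit through the letter `x` that this jump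
  -- carries.
  last-exits : ∀ {a b x y z} →
    (B : Block y z (U ++ a ∷ b ∷ x ∷ y ∷ z ∷ []) (x ∷ U ++ a ∷ b ∷ y ∷ z ∷ [])) →
    ∀ {c} → c ∈ t → c ≢ y → c ≢ z → c ≢ x → Exit c y z (Block.nodes B)
  last-exits B c∈ c≢y c≢z c≢x with Block.exits B c∈ c≢y c≢z
  ... | inj₁ ex = ex
  ... | inj₂ (W , eq , _) = contradiction (sym (third-letter U W eq)) c≢x

  -- The blocks fit together under τ_n: each begins with the last letter of the word that ends the
  -- one before, and `U01342` leads to `2U0134`, where the first block begins.
  module Ring
    (e₁ : t ~ U ++ 0 ∷ 1 ∷ 2 ∷ 3 ∷ 4 ∷ []) (e₂ : t ~ U ++ 4 ∷ 0 ∷ 1 ∷ 2 ∷ 3 ∷ [])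
    (e₃ : t ~ U ++ 3 ∷ 4 ∷ 0 ∷ 1 ∷ 2 ∷ []) (e₄ : t ~ U ++ 3 ∷ 4 ∷ 2 ∷ 0 ∷ 1 ∷ [])
    (e₅ : t ~ U ++ 1 ∷ 3 ∷ 4 ∷ 2 ∷ 0 ∷ []) (e₆ : t ~ U ++ 0 ∷ 1 ∷ 3 ∷ 4 ∷ 2 ∷ [])
    (B₁ : Block 3 4 (U ++ 0 ∷ 1 ∷ 2 ∷ 3 ∷ 4 ∷ []) (2 ∷ U ++ 0 ∷ 1 ∷ 3 ∷ 4 ∷ []))
    (B₂ : Block 2 3 (U ++ 4 ∷ 0 ∷ 1 ∷ 2 ∷ 3 ∷ []) (4 ∷ U ++ 0 ∷ 1 ∷ 2 ∷ 3 ∷ []))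
    (B₃ : Block 1 2 (U ++ 3 ∷ 4 ∷ 0 ∷ 1 ∷ 2 ∷ []) (3 ∷ U ++ 4 ∷ 0 ∷ 1 ∷ 2 ∷ []))
    (B₄ : Block 0 1 (U ++ 3 ∷ 4 ∷ 2 ∷ 0 ∷ 1 ∷ []) (2 ∷ U ++ 3 ∷ 4 ∷ 0 ∷ 1 ∷ []))
    (B₅ : Block 2 0 (U ++ 1 ∷ 3 ∷ 4 ∷ 2 ∷ 0 ∷ []) (1 ∷ U ++ 3 ∷ 4 ∷ 2 ∷ 0 ∷ []))
    (B₆ : Block 4 2 (U ++ 0 ∷ 1 ∷ 3 ∷ 4 ∷ 2 ∷ []) (0 ∷ U ++ 1 ∷ 3 ∷ 4 ∷ 2 ∷ [])) where

    module B₁ = Block B₁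
    module B₂ = Block B₂
    module B₃ = Block B₃
    module B₄ = Block B₄
    module B₅ = Block B₅
    module B₆ = Block B₆

    add : ∀ {q L N N′} → Cover [ q ] N → Cover L N′ → {False (q ∈²? L)} → Cover (q ∷ L) (N ++ N′)
    add C C′ {q∉} = cover-++ C C′ (λ { (here refl) → toWitnessFalse q∉ }) ↭-refl

    -- Only the exits through 2 from `(3 , 4)` and from `(0 , 1)` may be lost. As `(4 , 2)` and
    -- `(1 , 2)` lie in `ring`, no later triangle asks for them.
    avail : Available ring (B₁.nodes ++ B₂.nodes ++ B₃.nodes ++ B₄.nodes ++ B₅.nodes ++ B₆.nodes)
    avail x∈ x≢y x≢z (here refl) zx∉ _ = exit-++ˡ _
      (last-exits B₁ x∈ x≢y x≢z λ { refl → zx∉ (there (there (there (there (there (here refl)))))) })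
    avail x∈ x≢y x≢z (there (here refl)) _ _ = exit-++ʳ B₁.nodes (exit-++ˡ _
      (third-exits (λ ()) B₂ x∈ x≢y x≢z))
    avail x∈ x≢y x≢z (there (there (here refl))) _ _ = exit-++ʳ B₁.nodes (exit-++ʳ B₂.nodes (exit-++ˡ _
      (third-exits (λ ()) B₃ x∈ x≢y x≢z)))
    avail x∈ x≢y x≢z (there (there (there (here refl)))) zx∉ _ =
      exit-++ʳ B₁.nodes (exit-++ʳ B₂.nodes (exit-++ʳ B₃.nodes (exit-++ˡ _
      (last-exits B₄ x∈ x≢y x≢z λ { refl → zx∉ (there (there (here refl))) }))))
    avail x∈ x≢y x≢z (there (there (there (there (here refl))))) _ _ =
      exit-++ʳ B₁.nodes (exit-++ʳ B₂.nodes (exit-++ʳ B₃.nodes (exit-++ʳ B₄.nodes (exit-++ˡ _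
      (third-exits (λ ()) B₅ x∈ x≢y x≢z)))))
    avail x∈ x≢y x≢z (there (there (there (there (there (here refl)))))) _ _ =
      exit-++ʳ B₁.nodes (exit-++ʳ B₂.nodes (exit-++ʳ B₃.nodes (exit-++ʳ B₄.nodes (exit-++ʳ B₅.nodes
      (third-exits (λ ()) B₆ x∈ x≢y x≢z)))))

    joined : State ring
    joined = state (B₁.nodes ++ B₂.nodes ++ B₃.nodes ++ B₄.nodes ++ B₅.nodes ++ B₆.nodes)
      (path-++ B₁.path (long-jump₅ U 0 1 2 3 4 e₁) (path-++ B₂.path (long-jump₅ U 4 0 1 2 3 e₂)
        (path-++ B₃.path (long-jump₅ U 3 4 0 1 2 e₃) (path-++ B₄.path (long-jump₅ U 3 4 2 0 1 e₄)
        (path-++ B₅.path (long-jump₅ U 1 3 4 2 0 e₅) B₆.path)))))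
      (long-jump₅ U 0 1 3 4 2 e₆)
      (add B₁.cov (add B₂.cov (add B₃.cov (add B₄.cov (add B₅.cov B₆.cov)))))
      avail
      (0 , 2 , 3 , exit-++ʳ B₁.nodes (exit-++ˡ _
        (third-exits (λ ()) B₂ (∈-++⁺ʳ U (here refl)) (λ ()) (λ ()))))

  abstract

    initial : State ring
    initial = Ring.joined e₁ e₂ e₃ e₄ e₅ e₆
      (last-block₅ U 0 1 2 3 4 e₁) (third-block U 4 0 1 2 3 e₂) (third-block U 3 4 0 1 2 e₃)
      (last-block₅ U 3 4 2 0 1 e₄) (third-block U 1 3 4 2 0 e₅) (third-block U 0 1 3 4 2 e₆)
      where
      e₁ : t ~ U ++ 0 ∷ 1 ∷ 2 ∷ 3 ∷ 4 ∷ []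
      e₁ = ~-refl
      -- From here each word comes from the one before by moving a letter past two or four others,
      -- so evenness is a computation on five letters.
      e₂ : t ~ U ++ 4 ∷ 0 ∷ 1 ∷ 2 ∷ 3 ∷ []
      e₂ = ~-trans e₁ (~-++ˡ U (shift 4 (0 ∷ 1 ∷ 2 ∷ 3 ∷ []) [] , refl))
      e₃ : t ~ U ++ 3 ∷ 4 ∷ 0 ∷ 1 ∷ 2 ∷ []
      e₃ = ~-trans e₂ (~-++ˡ U (shift 3 (4 ∷ 0 ∷ 1 ∷ 2 ∷ []) [] , refl))
      e₄ : t ~ U ++ 3 ∷ 4 ∷ 2 ∷ 0 ∷ 1 ∷ []
      e₄ = ~-trans e₃ (~-++ˡ U (prep 3 (prep 4 (shift 2 (0 ∷ 1 ∷ []) [])) , refl))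
      e₅ : t ~ U ++ 1 ∷ 3 ∷ 4 ∷ 2 ∷ 0 ∷ []
      e₅ = ~-trans e₄ (~-++ˡ U (shift 1 (3 ∷ 4 ∷ 2 ∷ 0 ∷ []) [] , refl))
      e₆ : t ~ U ++ 0 ∷ 1 ∷ 3 ∷ 4 ∷ 2 ∷ []
      e₆ = ~-trans e₅ (~-++ˡ U (shift 0 (1 ∷ 3 ∷ 4 ∷ 2 ∷ []) [] , refl))

  -- Each triangle has its side `(y , z)` covered already and its two other sides new. Seven of them
  -- reach all twenty pairs, and the conditions are decided by evaluation.
  five : State pairs₅
  five = add 4 3 0 (add 3 1 0 (add 0 2 1 (add 4 0 1 (add 2 1 3 (add 4 1 2 (add 3 0 1 initial))))))
    where
    add : ∀ {L} x y z → State L → {True ((y , z) ∈²? L)} → {False ((z , x) ∈²? L)} → {False ((x , y) ∈²? L)} →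
      {True (x <? 5)} → {False (x ≟ y)} → {False (x ≟ z)} → State ((x , y) ∷ (z , x) ∷ L)
    add x y z s {yz∈} {zx∉} {xy∉} {x<5} {x≢y} {x≢z} = grow x y z s (toWitness yz∈) (toWitnessFalse zx∉)
      (toWitnessFalse xy∉) (<⇒∈-t (≤-trans (toWitness x<5) (m≤m+n 5 j))) (toWitnessFalse x≢y) (toWitnessFalse x≢z)

  -- The new letter m is joined to the old ones along the cycle 0 → 1 → … → m-1 → 0.
  module _ {m : ℕ} (2≤m : 2 ≤ m) (m< : m < 5 + j) where

    Old : ℕ → ℕ → Set
    Old a b = a < m × b < m × a ≢ b

    -- The pairs covered once the arcs `0 → 1`, ..., `i - 1 → i` have been used. The arc `i → i + 1`
    -- contributes `(m , i)` and `(i + 1 , m)`, hence the different bounds on the two sides.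
    Partial : ℕ → List Pair → Set
    Partial i L = (∀ {a b} → (a , b) ∈ L → Old a b ⊎ (1 ≤ a × a ≤ i × b ≡ m) ⊎ (a ≡ m × b < i)) ×
      (∀ {a b} → Old a b ⊎ (1 ≤ a × a ≤ i × b ≡ m) ⊎ (a ≡ m × b < i) → (a , b) ∈ L)

    along : ∀ {L} → State L → Full m L → ∀ i → i < m →
      ∃ λ L′ → State L′ × Partial i L′ × length L′ ≡ 2 * i + length L
    along {L} s (f , g) zero i<m = L , s , ((λ q → inj₁ (f q)) ,
      λ { (inj₁ (a<m , b<m , a≢b)) → g a<m b<m a≢b
        ; (inj₂ (inj₁ (1≤a , a≤0 , _))) → contradiction (≤-trans 1≤a a≤0) λ ()
        ; (inj₂ (inj₂ (_ , ()))) }) , refl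
    along {L} s full (suc i) i<m with along s full i (<-trans (n<1+n i) i<m)
    ... | L′ , s′ , (f , g) , size =
      _ , grow m i (suc i) s′ (g (inj₁ (i<m′ , i<m , <⇒≢ (n<1+n i)))) out₁ out₂ (<⇒∈-t m<) (>⇒≢ i<m′) (>⇒≢ i<m) ,
      (f′ , g′) , trans (cong (2 +_) size) (cong (_+ length L) (sym (*-suc 2 i)))
      where
      i<m′ : i < m
      i<m′ = <-trans (n<1+n i) i<m
      out₁ : (suc i , m) ∉ L′
      out₁ q with f q
      ... | inj₁ (_ , m<m , _) = <-irrefl refl m<m
      ... | inj₂ (inj₁ (_ , i<i , _)) = <-irrefl refl i<i
      ... | inj₂ (inj₂ (refl , _)) = <-irrefl refl i<m
      out₂ : (m , i) ∉ L′
      out₂ q with f q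
      ... | inj₁ (m<m , _) = <-irrefl refl m<m
      ... | inj₂ (inj₁ (_ , _ , refl)) = <-irrefl refl i<m′
      ... | inj₂ (inj₂ (_ , i<i)) = <-irrefl refl i<i
      f′ : ∀ {a b} → (a , b) ∈ (m , i) ∷ (suc i , m) ∷ L′ → Old a b ⊎ (1 ≤ a × a ≤ suc i × b ≡ m) ⊎ (a ≡ m × b < suc i)
      f′ (here refl) = inj₂ (inj₂ (refl , ≤-refl))
      f′ (there (here refl)) = inj₂ (inj₁ (s≤s z≤n , ≤-refl , refl))
      f′ (there (there q)) with f q
      ... | inj₁ o = inj₁ o
      ... | inj₂ (inj₁ (1≤a , a≤i , eq)) = inj₂ (inj₁ (1≤a , m≤n⇒m≤1+n a≤i , eq))
      ... | inj₂ (inj₂ (eq , b<i)) = inj₂ (inj₂ (eq , m<n⇒m<1+n b<i))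
      g′ : ∀ {a b} → Old a b ⊎ (1 ≤ a × a ≤ suc i × b ≡ m) ⊎ (a ≡ m × b < suc i) → (a , b) ∈ (m , i) ∷ (suc i , m) ∷ L′
      g′ (inj₁ o) = there (there (g (inj₁ o)))
      g′ {a} (inj₂ (inj₁ (1≤a , a≤1+i , refl))) with a ≟ suc i
      ... | yes refl = there (here refl)
      ... | no a≢ = there (there (g (inj₂ (inj₁ (1≤a , ≤-pred (≤∧≢⇒< a≤1+i a≢) , refl)))))
      g′ {b = b} (inj₂ (inj₂ (refl , b<1+i))) with b ≟ i
      ... | yes refl = here refl
      ... | no b≢ = there (there (g (inj₂ (inj₂ (refl , ≤∧≢⇒< (≤-pred b<1+i) b≢)))))

    add-letter : ∀ {L} → State L → Full m L → ∃ λ L′ → State L′ × Full (suc m) L′ × length L′ ≡ 2 * m + length L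
    add-letter {L} s full = finish 2≤m refl
      where
      finish : ∀ {k} → 2 ≤ k → k ≡ m → ∃ λ L′ → State L′ × Full (suc m) L′ × length L′ ≡ 2 * m + length L
      finish {suc i} (s≤s 1≤i) refl with along s full i ≤-refl
      ... | L′ , s′ , (f , g) , size =
        -- The closing arc `m - 1 → 0` supplies the missing pairs `(m , m - 1)` and `(0 , m)`; its
        -- ends differ because `2 ≤ m`.
        _ , grow m i 0 s′ (g (inj₁ (≤-refl , s≤s z≤n , >⇒≢ 1≤i))) out₁ out₂ (<⇒∈-t m<) (>⇒≢ ≤-refl) (λ ()) ,
        (f′ , g′) , trans (cong (2 +_) size) (cong (_+ length L) (sym (*-suc 2 i)))
        where
        out₁ : (0 , m) ∉ L′
        out₁ q with f q
        ... | inj₁ (_ , m<m , _) = <-irrefl refl m<m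
        ... | inj₂ (inj₁ (() , _))
        ... | inj₂ (inj₂ (() , _))
        out₂ : (m , i) ∉ L′
        out₂ q with f q
        ... | inj₁ (m<m , _) = <-irrefl refl m<m
        ... | inj₂ (inj₁ (_ , m≤i , _)) = <-irrefl refl m≤i
        ... | inj₂ (inj₂ (_ , i<i)) = <-irrefl refl i<i
        f′ : ∀ {a b} → (a , b) ∈ (m , i) ∷ (0 , m) ∷ L′ → a < suc m × b < suc m × a ≢ b
        f′ (here refl) = ≤-refl , m<n⇒m<1+n ≤-refl , >⇒≢ ≤-refl
        f′ (there (here refl)) = s≤s z≤n , ≤-refl , λ ()
        f′ (there (there q)) with f q
        ... | inj₁ (a<m , b<m , a≢b) = m<n⇒m<1+n a<m , m<n⇒m<1+n b<m , a≢b
        ... | inj₂ (inj₁ (_ , a≤i , refl)) = s≤s (m≤n⇒m≤1+n a≤i) , ≤-refl , <⇒≢ (s≤s a≤i)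
        ... | inj₂ (inj₂ (refl , b<i)) = ≤-refl , m<n⇒m<1+n (m<n⇒m<1+n b<i) , >⇒≢ (m<n⇒m<1+n b<i)
        g′ : ∀ {a b} → a < suc m → b < suc m → a ≢ b → (a , b) ∈ (m , i) ∷ (0 , m) ∷ L′
        g′ {a} {b} a< b< a≢b with a ≟ m | b ≟ m
        ... | yes refl | yes refl = contradiction refl a≢b
        ... | no a≢m | no b≢m = there (there (g (inj₁ (≤∧≢⇒< (≤-pred a<) a≢m , ≤∧≢⇒< (≤-pred b<) b≢m , a≢b))))
        ... | yes refl | no b≢m with b ≟ i
        ... | yes refl = here refl
        ... | no b≢i = there (there (g (inj₂ (inj₂ (refl , ≤∧≢⇒< (≤-pred (≤∧≢⇒< (≤-pred b<) b≢m)) b≢i)))))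
        g′ {zero} a< b< a≢b | no a≢m | yes refl = there (here refl)
        g′ {suc a} a< b< a≢b | no a≢m | yes refl =
          there (there (g (inj₂ (inj₁ (s≤s z≤n , ≤-pred (≤∧≢⇒< (≤-pred a<) a≢m) , refl)))))

  -- Indexed by the largest letter in use, not by the number of letters.
  Filled : ℕ → Set
  Filled m = ∃ λ L → State L × Full (suc m) L × length L ≡ suc m * m

  fill-next : ∀ {m} → 1 ≤ m → suc m < 5 + j → Filled m → Filled (suc m)
  fill-next {m} 1≤m m< (L , s , full , size) =
    let L′ , s′ , full′ , size′ = add-letter (s≤s 1≤m) m< s full in
    L′ , s′ , full′ , trans size′ (trans (cong (2 * suc m +_) size) (pair-count m))

  fill-zero : Filled 4
  fill-zero = pairs₅ , five , full₅ , refl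

  fill : ∀ i → i ≤ j → Filled (4 + i)
  fill zero    _   = fill-zero
  fill (suc i) i<j = fill-next (s≤s z≤n) (+-monoʳ-< 5 i<j) (fill i (≤-trans (n≤1+n i) i<j))

  -- Once every pair is covered, each even word lies in one of the joined cosets, so the cycle is a
  -- tour; the spare step then lets `tours` prescribe its closing jump.
  conclude : Filled (4 + j) → Tours (5 + j) ((5 + j) * (4 + j) * ℓ)
  conclude (L , state {start} {stop} nodes path closing cov _ (_ , _ , _ , _ , st) , (_ , full) , size) =
    subst₂ Tours (trans (sym (↭-length (perm t~stop))) length-t) (trans (Cover.size cov) (cong (_* ℓ) size))
      (tours whole (~-unique t~stop unique-t) (subst (3 ≤_) (trans (sym length-t) (↭-length (perm t~stop))) (s≤s (s≤s (s≤s z≤n)))) st)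
    where
    t~stop : t ~ stop
    t~stop = proj₁ (Cover.sound cov (path-last path))
    complete : ∀ {w} → t ~ w → w ∈ nodes
    complete {w} t~w with initLast w
    ... | [] = contradiction (trans (sym length-t) (↭-length (perm t~w))) λ ()
    ... | V ∷ʳ′ z with initLast V
    ... | [] = contradiction (trans (sym length-t) (↭-length (perm t~w))) λ ()
    ... | V′ ∷ʳ′ y = subst (_∈ nodes) (sym (++-assoc V′ [ y ] [ z ]))
      (Cover.complete cov (full (letter (here refl)) (letter (there (here refl))) y≢z) t~w′)
      where
      t~w′ : t ~ V′ ++ y ∷ z ∷ []
      t~w′ = ~-trans t~w (~-reflexive (++-assoc V′ [ y ] [ z ]))
      letter : ∀ {x} → x ∈ y ∷ z ∷ [] → x < 5 + j
      letter x∈ = ∈-t⇒< (∈-resp-↭ (↭-sym (perm t~w′)) (∈-++⁺ʳ V′ x∈))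
      y≢z : y ≢ z
      y≢z refl = unique-disjoint (V′ ++ [ y ]) (~-unique t~w unique-t) (∈-++⁺ʳ V′ (here refl)) (here refl)
    whole : Tour stop start nodes
    whole = tour path closing (Cover.unique cov) (λ w∈ → ~-trans (~-sym t~stop) (proj₁ (Cover.sound cov w∈)))
      (λ stop~w → complete (~-trans t~stop stop~w))

  next-tours : Tours (5 + j) ((5 + j) * (4 + j) * ℓ)
  next-tours = conclude (fill j ≤-refl)

-- The base case n = 7

data Size : Set where
  three five seven : Size

jump₇ : Size → Word → Word
jump₇ three (a ∷ b ∷ c ∷ w)                 = c ∷ a ∷ b ∷ w
jump₇ five  (a ∷ b ∷ c ∷ d ∷ e ∷ w)         = e ∷ a ∷ b ∷ c ∷ d ∷ w
jump₇ seven (a ∷ b ∷ c ∷ d ∷ e ∷ f ∷ g ∷ w) = g ∷ a ∷ b ∷ c ∷ d ∷ e ∷ f ∷ w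
jump₇ _     w                               = w

jump₇-jump : ∀ k w → length w ≡ 7 → Jump w (jump₇ k w)
jump₇-jump three (a ∷ b ∷ c ∷ w) _ = jump (a ∷ b ∷ []) c w two refl refl
jump₇-jump five (a ∷ b ∷ c ∷ d ∷ e ∷ w) _ = jump (a ∷ b ∷ c ∷ d ∷ []) e w (more two) refl refl
jump₇-jump seven (a ∷ b ∷ c ∷ d ∷ e ∷ f ∷ g ∷ w) _ =
  jump (a ∷ b ∷ c ∷ d ∷ e ∷ f ∷ []) g w (more (more two)) refl refl

jump-~ : ∀ {u v} → Unique u → Jump u v → u ~ v
jump-~ u (jump as x bs e refl refl) = ~-shift [] as x bs u e

trace : Word → List Size → List Word
trace w []       = w ∷ []
trace w (k ∷ ks) = w ∷ trace (jump₇ k w) ks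

trace-path : ∀ w ks → length w ≡ 7 → Unique w →
  Path Jump w (trace w ks) (foldl (λ v k → jump₇ k v) w ks) × (∀ {v} → v ∈ trace w ks → w ~ v)
trace-path w []       len u = end , λ { (here refl) → ~-refl }
trace-path w (k ∷ ks) len u = J ∷ proj₁ rest , λ { (here refl) → ~-refl ; (there v∈) → ~-trans e (proj₂ rest v∈) }
  where
  J = jump₇-jump k w len
  e = jump-~ u J
  rest = trace-path (jump₇ k w) ks (trans (sym (↭-length (perm e))) len) (~-unique e u)

-- Distinctness is tested by sorting the words into buckets by their successive letters.

after : ℕ → List Word → List Word
after a []             = []
after a ([] ∷ ws)      = after a ws
after a ((b ∷ w) ∷ ws) with a ≟ b
... | yes _ = w ∷ after a ws
... | no  _ = after a ws

∈-after : ∀ {a w} ws → a ∷ w ∈ ws → w ∈ after a ws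
∈-after {a} ((b ∷ v) ∷ ws) w∈ with a ≟ b | w∈
... | yes _  | here refl = here refl
... | yes _  | there w∈′ = there (∈-after ws w∈′)
... | no a≢b | here refl = contradiction refl a≢b
... | no _   | there w∈′ = ∈-after ws w∈′
∈-after ([] ∷ ws) (there w∈) = ∈-after ws w∈

Long : ℕ → Word → Set
Long zero    w       = ⊤
Long (suc d) []      = ⊥
Long (suc d) (a ∷ w) = a < 7 × Long d w

after-long : ∀ {d} a ws → All (Long (suc d)) ws → All (Long d) (after a ws)
after-long a []             []               = []
after-long a ((b ∷ w) ∷ ws) ((_ , l) ∷ ls) with a ≟ b
... | yes _ = l ∷ after-long a ws ls
... | no  _ = after-long a ws ls

after-unique : ∀ {d} ws → All (Long (suc d)) ws → (∀ {a} → a < 7 → Unique (after a ws)) → Unique ws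
after-unique []             []              h = []
after-unique ((b ∷ w) ∷ ws) ((b<7 , _) ∷ ls) h = All.tabulate fresh ∷ after-unique ws ls rest
  where
  bucket : Unique (w ∷ after b ws)
  bucket with b ≟ b | h b<7
  ... | yes _ | u = u
  ... | no b≢b | _ = contradiction refl b≢b
  fresh : ∀ {v} → v ∈ ws → b ∷ w ≢ v
  fresh v∈ refl = unique-head bucket (∈-after ws v∈)
  rest : ∀ {a} → a < 7 → Unique (after a ws)
  rest {a} a<7 with a ≟ b | h a<7
  ... | yes _ | u = unique-tail u
  ... | no _  | u = u

-- It is applied with depth 5: the first five letters determine an even word on seven letters, so
-- each final bucket of a repetition-free list holds at most one word.
distinct     : ℕ → List Word → Bool
distinctUpTo : ℕ → ℕ → List Word → Bool
distinct zero    []          = true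
distinct zero    (_ ∷ [])    = true
distinct zero    (_ ∷ _ ∷ _) = false
distinct (suc d) ws          = distinctUpTo 7 d ws
distinctUpTo zero    d ws = true
distinctUpTo (suc a) d ws = distinct d (after a ws) ∧ distinctUpTo a d ws

∧-true : ∀ {a b} → a ∧ b ≡ true → a ≡ true × b ≡ true
∧-true {true} eq = refl , eq

distinct-sound     : ∀ d ws → All (Long d) ws → distinct d ws ≡ true → Unique ws
distinctUpTo-sound : ∀ n d ws → All (Long (suc d)) ws → distinctUpTo n d ws ≡ true →
  ∀ {a} → a < n → Unique (after a ws)
distinct-sound zero    []       ls eq = []
distinct-sound zero    (_ ∷ []) ls eq = [] ∷ []
distinct-sound (suc d) ws       ls eq = after-unique ws ls (distinctUpTo-sound 7 d ws ls eq)
distinctUpTo-sound (suc n) d ws ls eq {a} a<1+n with a ≟ n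
... | yes refl = distinct-sound d (after n ws) (after-long n ws ls) (proj₁ (∧-true eq))
... | no a≢n   = distinctUpTo-sound n d ws ls (proj₂ (∧-true {distinct d (after n ws)} eq)) (≤∧≢⇒< (≤-pred a<1+n) a≢n)

long-rearrangement : ∀ w → upTo 7 ~ w → Long 5 w
long-rearrangement w e with w | ↭-length (perm e) | All.tabulate {P = _< 7} (λ {x} x∈ → ∈-upTo⁻ (∈-resp-↭ (↭-sym (perm e)) x∈))
... | a ∷ b ∷ c ∷ d ∷ f ∷ _ | _ | a< ∷ b< ∷ c< ∷ d< ∷ f< ∷ _ = a< , b< , c< , d< , f< , tt

insertions : ℕ → Word → List Word
insertions x []       = [ [ x ] ]
insertions x (y ∷ ys) = (x ∷ y ∷ ys) ∷ map (y ∷_) (insertions x ys)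

arrangements : Word → List Word
arrangements []       = [ [] ]
arrangements (x ∷ xs) = concatMap (insertions x) (arrangements xs)

∈-insertions : ∀ x as bs → as ++ x ∷ bs ∈ insertions x (as ++ bs)
∈-insertions x []       []       = here refl
∈-insertions x []       (b ∷ bs) = here refl
∈-insertions x (a ∷ as) bs       = there (∈-map⁺ (a ∷_) (∈-insertions x as bs))

∈-arrangements : ∀ t {w} → t ↭ w → w ∈ arrangements t
∈-arrangements [] p with ↭-empty-inv (↭-sym p)
... | refl = here refl
∈-arrangements (x ∷ t) p with ∈-∃++ (∈-resp-↭ p (here refl))
... | as , bs , refl = ∈-concatMap⁺ (insertions x) {xs = arrangements t}
  (lose (∈-arrangements t (drop-∷ (↭-trans p (shift x as bs)))) (∈-insertions x as bs))

evens₇ : List Word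
evens₇ = filter (λ w → par w Bool.≟ false) (arrangements (upTo 7))

digits : ℕ → ℕ → List Size → List Size
digits zero    d ks = ks
digits (suc n) d ks = digits n (d / 10) (size (d % 10) ∷ ks)
  where
  size : ℕ → Size
  size 3 = three
  size 5 = five
  size _ = seven

-- The decimal digits are the successive k of the generators τ_k. Their product has order 5, and the
-- cycle repeats them five times; it was found by a computer search.
fifth : List Size
fifth = concatMap (λ d → digits 72 d [])
  (777757775775537335357577777757755355775733775773575777373757737757777577
  ∷ 577777357777737537377557575577335357733553755773777377753733577777375773
  ∷ 773777777377777733537375775773757377375577755777555575357777575537577577
  ∷ 535373375577777575577375375357577555373575757775757535737775357577755577
  ∷ 757757537377737575757773357573573757773777355757777755575777757557337735
  ∷ 575577575575773753555375757757737375737755757753355577577373377777575755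
  ∷ 373377573757357557753573577777537377557775753357357537777775757737377757 ∷ [])

start₇ : Word
start₇ = 6 ∷ 0 ∷ 1 ∷ 2 ∷ 3 ∷ 4 ∷ 5 ∷ []

-- The four facts that need evaluation of the concrete cycle enter as hypotheses; the rest holds for
-- every continuation `ks`. The 2520 distinct even words met are all of them, as `evens₇` has just
-- as many.
module Base (ks : List Size)
  (closes : foldl (λ v k → jump₇ k v) start₇ (seven ∷ seven ∷ seven ∷ five ∷ ks) ≡ upTo 7)
  (distinct-nodes : distinct 5 (trace start₇ (seven ∷ seven ∷ seven ∷ five ∷ ks)) ≡ true)
  (size : length (trace start₇ (seven ∷ seven ∷ seven ∷ five ∷ ks)) ≡ 2520)
  (evens-size : length evens₇ ≡ 2520) where

  nodes : List Word
  nodes = trace start₇ (seven ∷ seven ∷ seven ∷ five ∷ ks)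

  first-jump : Jump (upTo 7) start₇
  first-jump = jump₇-jump seven (upTo 7) refl

  start~ : upTo 7 ~ start₇
  start~ = jump-~ (Unique.upTo⁺ 7) first-jump

  walk : Path Jump start₇ nodes _ × (∀ {v} → v ∈ nodes → start₇ ~ v)
  walk = trace-path start₇ (seven ∷ seven ∷ seven ∷ five ∷ ks) refl (~-unique start~ (Unique.upTo⁺ 7))

  sound : ∀ {w} → w ∈ nodes → upTo 7 ~ w
  sound w∈ = ~-trans start~ (proj₂ walk w∈)

  nodes-unique : Unique nodes
  nodes-unique = distinct-sound 5 nodes (All.tabulate (λ {w} w∈ → long-rearrangement w (sound w∈))) distinct-nodes

  even : ∀ {w} → upTo 7 ~ w → w ∈ evens₇
  even (p , q) = ∈-filter⁺ (λ w → par w Bool.≟ false) (∈-arrangements (upTo 7) p) (sym q)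

  complete : ∀ {w} → upTo 7 ~ w → w ∈ nodes
  complete e = ∈-resp-↭ (↭-sym (unique-⊆-↭ nodes-unique (λ w∈ → even (sound w∈)) (trans size (sym evens-size)))) (even e)

  tour₇ : Tour (upTo 7) start₇ nodes
  tour₇ = tour (subst (Path Jump start₇ nodes) closes (proj₁ walk)) first-jump nodes-unique sound complete

  -- The τ_5 step that `tours` requires for seven letters, with `W = 3456`: three applications of
  -- τ_7 lead from `start₇` to its source.
  fifth-step : ∀ ks → Step (3 ∷ 4 ∷ 5 ∷ 6 ∷ 0 ∷ 1 ∷ 2 ∷ []) (0 ∷ 3 ∷ 4 ∷ 5 ∷ 6 ∷ 1 ∷ 2 ∷ [])
    (trace start₇ (seven ∷ seven ∷ seven ∷ five ∷ ks))
  fifth-step []      = there (there (there here))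
  fifth-step (_ ∷ _) = there (there (there here))

  tours₇ : Tours 7 2520
  tours₇ = subst (Tours 7) size
    (tours {W = 3 ∷ 4 ∷ 5 ∷ 6 ∷ []} {0} {1} {2} tour₇ (Unique.upTo⁺ 7) (s≤s (s≤s (s≤s z≤n))) (fifth-step ks))

-- From the identity the cycle goes first to start₇ by τ_7, then along τ_7, τ_7, τ_7, τ_5.
rest₇ : List Size
rest₇ = drop 5 fifth ++ fifth ++ fifth ++ fifth ++ fifth

tours₇ : Tours 7 2520
tours₇ = Base.tours₇ rest₇ refl refl refl refl

-- Induction over odd n

evenPos-8 : ∀ i → EvenPos (8 + i * 2)
evenPos-8 zero    = more (more (more two))
evenPos-8 (suc i) = more (evenPos-8 i)

half-factorial : ∀ n ℓ → ℓ * 2 ≡ n ! → (2 + n) * (1 + n) * ℓ * 2 ≡ (2 + n) !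
half-factorial n ℓ eq = trans (*-assoc ((2 + n) * (1 + n)) ℓ 2)
  (trans (cong ((2 + n) * (1 + n) *_) eq) (*-assoc (2 + n) (1 + n) (n !)))

HalfTours : ℕ → Set
HalfTours n = ∃ λ ℓ → Tours n ℓ × ℓ * 2 ≡ n !

next-half : ∀ j → EvenPos (4 + j) → HalfTours (3 + j) → HalfTours (5 + j)
next-half j e (ℓ , T , eq) = (5 + j) * (4 + j) * ℓ , Growth.next-tours j e T , half-factorial (3 + j) ℓ eq

half-tours : ∀ i → HalfTours (7 + i * 2)
half-tours zero    = 2520 , tours₇ , refl
-- With `j = 4 + 2i` the shorter words have `3 + j = 7 + 2i` letters, the longer ones
-- `5 + j = 9 + 2i`, and `4 + j = 8 + 2i` is even.
half-tours (suc i) = next-half (4 + i * 2) (evenPos-8 i) (half-tours i)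

-- One-line notation as a word

word : ∀ {m n} → Vec (Fin m) n → Word
word v = map toℕ (toList v)

length-word : ∀ {m n} (v : Vec (Fin m) n) → length (word v) ≡ n
length-word v = trans (length-map toℕ (toList v)) (length-toList v)

word-injective : ∀ {m n} (u v : Vec (Fin m) n) → word u ≡ word v → u ≡ v
word-injective []      []      eq = refl
word-injective (x ∷ u) (y ∷ v) eq =
  cong₂ _∷_ (toℕ-injective (proj₁ (∷-injective eq))) (word-injective u v (proj₂ (∷-injective eq)))

nth : Word → ℕ → ℕ
nth []      i       = 0
nth (x ∷ w) zero    = x
nth (x ∷ w) (suc i) = nth w i

nth-word : ∀ {m n} (v : Vec (Fin m) n) i → nth (word v) (toℕ i) ≡ toℕ (lookup v i)
nth-word (x ∷ v) fzero    = refl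
nth-word (x ∷ v) (fsuc i) = nth-word v i

tabulate-nth : ∀ w {n} → length w ≡ n → List.tabulate {n = n} (λ i → nth w (toℕ i)) ≡ w
tabulate-nth []      refl = refl
tabulate-nth (x ∷ w) refl = cong (x ∷_) (tabulate-nth w refl)

toList-tabulate : ∀ {A : Set} {n} (f : Fin n → A) → toList (tabulate f) ≡ List.tabulate f
toList-tabulate {n = zero}  f = refl
toList-tabulate {n = suc n} f = cong (f fzero ∷_) (toList-tabulate (f ∘ fsuc))

toList-lookup : ∀ {A : Set} {n} (v : Vec A n) → List.tabulate (lookup v) ≡ toList v
toList-lookup []      = refl
toList-lookup (x ∷ v) = cong (x ∷_) (toList-lookup v)

toℕ-toFinOr : ∀ {n m} (i : Fin n) → m < n → toℕ (toFinOr m i) ≡ m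
toℕ-toFinOr {n} {m} i m<n with m <? n
... | yes p = toℕ-fromℕ< p
... | no ¬p = contradiction m<n ¬p

nth<  : ∀ {m} w {i} → All (_< m) w → i < length w → nth w i < m
nth< (x ∷ w) {zero}  (x< ∷ _) _         = x<
nth< (x ∷ w) {suc i} (_ ∷ l)  (s≤s i<) = nth< w l i<

-- Inverse to `word` on even rearrangements of `upTo n`, where the fallback `i` is never taken.
fromWord : ∀ {n} → Word → Perm n
fromWord w = tabulate (λ i → toFinOr (nth w (toℕ i)) i)

word-fromWord : ∀ {n w} → upTo n ~ w → word (fromWord {n} w) ≡ w
word-fromWord {n} {w} e = trans (cong (map toℕ) (toList-tabulate _)) (trans (List.map-tabulate _ toℕ)
  (trans (List.tabulate-cong (λ i → toℕ-toFinOr i (nth< w bounded (subst (toℕ i <_) (sym len) (toℕ<n i)))))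
    (tabulate-nth w len)))
  where
  len : length w ≡ n
  len = trans (sym (↭-length (perm e))) (length-upTo n)
  bounded : All (_< n) w
  bounded = All.tabulate (λ x∈ → ∈-upTo⁻ (∈-resp-↭ (↭-sym (perm e)) x∈))

fromWord-word : ∀ {n} (π : Perm n) → upTo n ~ word π → fromWord (word π) ≡ π
fromWord-word π e = word-injective (fromWord (word π)) π (word-fromWord e)

-- Inversion numbers

ind : Bool → ℕ
ind b = if b then 1 else 0

count : ℕ → Word → ℕ
count x []       = 0
count x (y ∷ ys) = ind (y <ᵇ x) + count x ys

inv : Word → ℕ
inv []       = 0
inv (x ∷ xs) = count x xs + inv xs

odd-+ : ∀ m n → odd (m + n) ≡ odd m xor odd n
odd-+ zero    n = refl
odd-+ (suc m) n = trans (cong not (odd-+ m n)) (Bool.not-distribˡ-xor (odd m) (odd n))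

odd-ind : ∀ b → odd (ind b) ≡ b
odd-ind true  = refl
odd-ind false = refl

odd-count : ∀ x w → odd (count x w) ≡ below x w
odd-count x []      = refl
odd-count x (y ∷ w) = trans (odd-+ (ind (y <ᵇ x)) _) (cong₂ _xor_ (odd-ind (y <ᵇ x)) (odd-count x w))

odd-inv : ∀ w → odd (inv w) ≡ par w
odd-inv []      = refl
odd-inv (x ∷ w) = trans (odd-+ (count x w) _) (cong₂ _xor_ (odd-count x w) (odd-inv w))

sum-count : ∀ {m n} x (v : Vec (Fin m) n) →
  sum (List.tabulate (λ j → ind (toℕ (lookup v j) <ᵇ x))) ≡ count x (word v)
sum-count x []      = refl
sum-count x (y ∷ v) = cong (ind (toℕ y <ᵇ x) +_) (sum-count x v)

inversion : ∀ {m n} → Vec (Fin m) n → Fin n → Fin n → ℕ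
inversion v i j = ind ((toℕ i <ᵇ toℕ j) ∧ (toℕ (lookup v j) <ᵇ toℕ (lookup v i)))

sum-inv : ∀ {m n} (v : Vec (Fin m) n) →
  sum (List.tabulate (λ i → sum (List.tabulate (inversion v i)))) ≡ inv (word v)
sum-inv []      = refl
sum-inv (x ∷ v) = cong₂ _+_ (sum-count (toℕ x) v) (sum-inv v)

invNum-word : ∀ {n} (π : Perm n) → invNum π ≡ inv (word π)
invNum-word {n} π = trans
  (cong sum (trans (List.map-tabulate id (λ i → sum (map (inversion π i) (allFin n))))
    (List.tabulate-cong (λ i → cong sum (List.map-tabulate id (inversion π i))))))
  (sum-inv π)

even⇒¬odd : ∀ n → n % 2 ≡ 0 → odd n ≡ false
even⇒¬odd zero          eq = refl
even⇒¬odd (suc (suc n)) eq = trans (not-involutive (odd n)) (even⇒¬odd n eq)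

¬odd⇒even : ∀ n → odd n ≡ false → n % 2 ≡ 0
¬odd⇒even zero          eq = refl
¬odd⇒even (suc (suc n)) eq = ¬odd⇒even n (trans (sym (not-involutive (odd n))) eq)

applyUpTo-cong : ∀ {f g : ℕ → ℕ} n → (∀ i → f i ≡ g i) → applyUpTo f n ≡ applyUpTo g n
applyUpTo-cong zero    h = refl
applyUpTo-cong (suc n) h = cong₂ _∷_ (h 0) (applyUpTo-cong n (h ∘ suc))

count-≥ : ∀ x k n → x ≤ k → count x (applyUpTo (k +_) n) ≡ 0
count-≥ x k zero    x≤k = refl
count-≥ x k (suc n) x≤k = cong₂ (λ b c → ind b + c)
  (<ᵇ-false (≤⇒≯ (≤-trans x≤k (m≤m+n k 0))))
  (trans (cong (count x) (applyUpTo-cong n (+-suc k))) (count-≥ x (suc k) n (m≤n⇒m≤1+n x≤k)))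

inv-applyUpTo : ∀ k n → inv (applyUpTo (k +_) n) ≡ 0
inv-applyUpTo k zero    = refl
inv-applyUpTo k (suc n) = cong₂ _+_
  (trans (cong (count (k + 0)) shifted) (count-≥ (k + 0) (suc k) n (subst (_≤ suc k) (sym (+-identityʳ k)) (n≤1+n k))))
  (trans (cong inv shifted) (inv-applyUpTo (suc k) n))
  where
  shifted : applyUpTo (λ i → k + suc i) n ≡ applyUpTo (suc k +_) n
  shifted = applyUpTo-cong n (+-suc k)

par-upTo : ∀ n → par (upTo n) ≡ false
par-upTo n = trans (sym (odd-inv (upTo n))) (cong odd (inv-applyUpTo 0 n))

word-↭ : ∀ {n} (π : Perm n) → IsPerm π → upTo n ↭ word π
word-↭ {n} π u = ↭-sym (unique-⊆-↭ (Unique.map⁺ toℕ-injective u) bounded (trans (length-word π) (sym (length-upTo n))))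
  where
  bounded : ∀ {x} → x ∈ word π → x ∈ upTo n
  bounded x∈ with ∈-map⁻ toℕ x∈
  ... | i , _ , refl = ∈-upTo⁺ (toℕ<n i)

InA⇒~ : ∀ {n} (π : Perm n) → InA π → upTo n ~ word π
InA⇒~ {n} π (u , e) = word-↭ π u , trans (par-upTo n)
  (sym (trans (sym (odd-inv (word π))) (trans (cong odd (sym (invNum-word π))) (even⇒¬odd (invNum π) e))))

~⇒InA : ∀ {n} (π : Perm n) → upTo n ~ word π → InA π
~⇒InA {n} π e = Unique.map⁻ (~-unique e (Unique.upTo⁺ n)) ,
  ¬odd⇒even (invNum π) (trans (cong odd (invNum-word π)) (trans (odd-inv (word π)) (trans (sym (parity e)) (par-upTo n))))

-- Jumps are multiplications by τ_k

nth-delete : ∀ as x bs i →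
  nth (as ++ bs) i ≡ nth (as ++ x ∷ bs) (if i <ᵇ length as then i else suc i)
nth-delete []       x bs i       = refl
nth-delete (a ∷ as) x bs zero    = refl
nth-delete (a ∷ as) x bs (suc i) = trans (nth-delete as x bs i) (push (i <ᵇ length as))
  where
  push : ∀ b → nth (as ++ x ∷ bs) (if b then i else suc i) ≡
    nth (a ∷ as ++ x ∷ bs) (if b then suc i else suc (suc i))
  push true  = refl
  push false = refl

-- Position 0 reads the letter that jumped, the next `length as` positions read one place to the
-- left, and later ones are unchanged: this is τ_k for `k = length as + 1`.
nth-jump : ∀ as x bs i → nth (x ∷ as ++ bs) i ≡ nth (as ++ x ∷ bs) (tauℕ (suc (length as)) i)
nth-jump []       x bs zero    = refl
nth-jump (a ∷ as) x bs zero    = nth-jump as x bs zero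
nth-jump as       x bs (suc i) = nth-delete as x bs i

tauℕ< : ∀ {n k i} → suc k ≤ n → i < n → tauℕ (suc k) i < n
tauℕ< {i = zero}      k<n i<n = k<n
tauℕ< {k = k} {suc i} k<n i<n with i <ᵇ k
... | true  = <-trans (n<1+n i) i<n
... | false = i<n

evenPos-% : ∀ {k} → EvenPos k → suc k % 2 ≡ 1 × 2 ≤ k
evenPos-% two      = refl , ≤-refl
evenPos-% (more e) = proj₁ (evenPos-% e) , m≤n⇒m≤1+n (m≤n⇒m≤1+n (proj₂ (evenPos-% e)))

jump⇒edge : ∀ {n} (π σ : Perm n) → Jump (word π) (word σ) → EdgeA n π σ
jump⇒edge {n} π σ (jump as x bs e src tgt) =
  suc (length as) , proj₁ (evenPos-% e) , s≤s (proj₂ (evenPos-% e)) , k≤n ,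
  trans (sym (tabulate∘lookup σ)) (tabulate-cong pointwise)
  where
  k≤n : suc (length as) ≤ n
  k≤n = subst (suc (length as) ≤_)
    (trans (sym (length-++ as)) (trans (cong length (sym src)) (length-word π)))
    (≤-trans (≤-reflexive (+-comm 1 (length as))) (+-monoʳ-≤ (length as) (s≤s z≤n)))
  pointwise : ∀ i → lookup σ i ≡ lookup π (lookup (tau n (suc (length as))) i)
  pointwise i = toℕ-injective (begin
    toℕ (lookup σ i)                                       ≡⟨ sym (nth-word σ i) ⟩
    nth (word σ) (toℕ i)                                   ≡⟨ cong (λ w → nth w (toℕ i)) tgt ⟩
    nth (x ∷ as ++ bs) (toℕ i)                             ≡⟨ nth-jump as x bs (toℕ i) ⟩
    nth (as ++ x ∷ bs) (tauℕ (suc (length as)) (toℕ i))    ≡⟨ cong (λ w → nth w _) (sym src) ⟩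
    nth (word π) (tauℕ (suc (length as)) (toℕ i))          ≡⟨ cong (nth (word π)) (sym target-position) ⟩
    nth (word π) (toℕ (lookup (tau n (suc (length as))) i)) ≡⟨ nth-word π _ ⟩
    toℕ (lookup π (lookup (tau n (suc (length as))) i))    ∎)
    where
    open ≡-Reasoning
    target-position : toℕ (lookup (tau n (suc (length as))) i) ≡ tauℕ (suc (length as)) (toℕ i)
    target-position = trans (cong toℕ (lookup∘tabulate _ i)) (toℕ-toFinOr i (tauℕ< k≤n (toℕ<n i)))

-- Kendall's distance

-- The left-hand side is the function local to pos, which has no name here; it is inferred from
-- the call in pos-unique.
search : ∀ {n} (π : Perm n) v {i} → lookup π i ≡ v → (∀ {j} → lookup π j ≡ v → j ≡ i) →
  (is : List (Fin n)) → i ∈ is → _ ≡ i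

pos-unique : ∀ {n} (π : Perm n) v {i} → lookup π i ≡ v → (∀ {j} → lookup π j ≡ v → j ≡ i) → pos π v ≡ i
pos-unique {n} π v {i} eq only with allFin n | ∈-allFin {n} i
... | is | i∈ = search π v eq only is i∈

search π v eq only (j ∷ is) i∈ with lookup π j ≟ᶠ v | i∈
... | yes eq′ | _         = only eq′
... | no neq  | here refl = contradiction eq neq
... | no _    | there i∈′ = search π v eq only is i∈′

lookup-∈ : ∀ {A : Set} {n} (v : Vec A n) i → lookup v i ∈ toList v
lookup-∈ (x ∷ v) fzero    = here refl
lookup-∈ (x ∷ v) (fsuc i) = there (lookup-∈ v i)

lookup-injective : ∀ {A : Set} {n} (v : Vec A n) → Unique (toList v) → ∀ {i j} → lookup v i ≡ lookup v j → i ≡ j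
lookup-injective (x ∷ v) u {fzero}  {fzero}  eq = refl
lookup-injective (x ∷ v) u {fzero}  {fsuc j} eq = contradiction (subst (_∈ toList v) (sym eq) (lookup-∈ v j)) (unique-head u)
lookup-injective (x ∷ v) u {fsuc i} {fzero}  eq = contradiction (subst (_∈ toList v) eq (lookup-∈ v i)) (unique-head u)
lookup-injective (x ∷ v) u {fsuc i} {fsuc j} eq = cong fsuc (lookup-injective v (unique-tail u) eq)

place : ∀ {n} → Perm n → Fin n → ℕ
place π v = toℕ (pos π v)

-- The one-line notation of π⁻¹σ lists, for each letter of σ, its place in π.
kendall-inv : ∀ {n} (π σ : Perm n) → kendall π σ ≡ inv (map (place π) (toList σ))
kendall-inv π σ = trans (invNum-word (inverse π ∘ₚ σ)) (cong inv
  (trans (cong (map toℕ) (toList-tabulate _)) (trans (List.map-tabulate _ toℕ)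
    (trans (List.tabulate-cong (λ i → cong toℕ (lookup∘tabulate (pos π) (lookup σ i))))
      (trans (sym (List.map-tabulate (lookup σ) (place π))) (cong (map (place π)) (toList-lookup σ)))))))

tabulate-toℕ : ∀ (f : ℕ → ℕ) n → List.tabulate {n = n} (f ∘ toℕ) ≡ applyUpTo f n
tabulate-toℕ f zero    = refl
tabulate-toℕ f (suc n) = cong (f 0 ∷_) (tabulate-toℕ (f ∘ suc) n)

map-place : ∀ {n} (π : Perm n) → IsPerm π → map (place π) (toList π) ≡ upTo n
map-place {n} π u = trans (cong (map (place π)) (sym (toList-lookup π))) (trans (List.map-tabulate (lookup π) (place π))
  (trans (List.tabulate-cong (λ i → cong toℕ (pos-unique π (lookup π i) refl (λ {j} → lookup-injective π u {j} {i}))))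
    (tabulate-toℕ id n)))

-- Replacing every letter by its place in `π` turns `π` into the identity and `σ` into π⁻¹σ. By
-- `relabel` the relative sign survives, so the distance is even.
kendall-even : ∀ {n} (π σ : Perm n) → InA π → InA σ → kendall π σ ≢ 1
kendall-even {n} π σ π∈ σ∈ eq = contradiction (trans (sym odd-kendall) (cong odd eq)) λ ()
  where
  Fin-↭ : ∀ (ρ : Perm n) → IsPerm ρ → toList ρ ↭ allFin n
  Fin-↭ ρ u = unique-⊆-↭ u (λ {i} _ → ∈-allFin i) (trans (length-toList ρ) (sym (List.length-tabulate id)))
  π~ = InA⇒~ π π∈
  even-word : ∀ {ρ : Perm n} → upTo n ~ word ρ → par (word ρ) ≡ false
  even-word e = trans (sym (parity e)) (par-upTo n)
  signs : par (word π) xor par (word σ) ≡ par (map (place π) (toList π)) xor par (map (place π) (toList σ))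
  signs = relabel toℕ (place π) (↭-trans (Fin-↭ π (proj₁ π∈)) (↭-sym (Fin-↭ σ (proj₁ σ∈))))
    (~-unique π~ (Unique.upTo⁺ n)) (subst Unique (sym (map-place π (proj₁ π∈))) (Unique.upTo⁺ n))
  even-place : par (map (place π) (toList π)) ≡ false
  even-place = trans (cong par (map-place π (proj₁ π∈))) (par-upTo n)
  odd-kendall : odd (kendall π σ) ≡ false
  odd-kendall = begin
    odd (kendall π σ)                                                 ≡⟨ cong odd (kendall-inv π σ) ⟩
    odd (inv (map (place π) (toList σ)))                              ≡⟨ odd-inv (map (place π) (toList σ)) ⟩
    par (map (place π) (toList σ))                                    ≡⟨ cong (_xor par (map (place π) (toList σ))) (sym even-place) ⟩
    par (map (place π) (toList π)) xor par (map (place π) (toList σ)) ≡⟨ sym signs ⟩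
    par (word π) xor par (word σ)                                     ≡⟨ cong₂ _xor_ (even-word {π} π~) (even-word {σ} (InA⇒~ σ σ∈)) ⟩
    false                                                             ∎
    where open ≡-Reasoning

flip : ∀ {A : Set} {n} → Vec A (2 + n) → Vec A (2 + n)
flip (a ∷ b ∷ v) = b ∷ a ∷ v

flip-involutive : ∀ {A : Set} {n} (v : Vec A (2 + n)) → flip (flip v) ≡ v
flip-involutive (a ∷ b ∷ v) = refl

-- Seen from `π`, its flip π(1 2) reads 1, 0, 2, 3, ..., which has a single inversion.
kendall-flip : ∀ {n} (π : Perm (2 + n)) → IsPerm π → kendall π (flip π) ≡ 1
kendall-flip {n} (a ∷ b ∷ v) u = trans (kendall-inv π (flip π)) one
  where
  π = a ∷ b ∷ v
  split = ∷-injective (map-place π u)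
  split′ = ∷-injective (proj₂ split)
  one : inv (place π b ∷ place π a ∷ map (place π) (toList v)) ≡ 1
  one = trans
    (cong₂ (λ i w → inv (i ∷ w)) (proj₁ split′) (cong₂ _∷_ (proj₁ split) (proj₂ split′)))
    (cong suc (cong₂ _+_ (count-≥ 1 2 n (s≤s z≤n)) (cong₂ _+_ (count-≥ 0 2 n z≤n) (inv-applyUpTo 2 n))))

-- Cycles of permutations

path-linked : ∀ {A : Set} {R : A → A → Set} {a b c xs} → Path R a xs b → R b c → Linked R (xs ++ [ c ])
path-linked end         r = r ∷ [-]
path-linked (s ∷ end)   r = s ∷ r ∷ [-]
path-linked (s ∷ q ∷ p) r = s ∷ path-linked (q ∷ p) r

path-cyclic : ∀ {A : Set} {R : A → A → Set} {a b xs} → Path R a xs b → R b a → CycLinked R xs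
path-cyclic end     r = r ∷ [-]
path-cyclic (s ∷ p) r = path-linked (s ∷ p) r

cyclic-map : ∀ {A : Set} {R S : A → A → Set} → (∀ {a b} → R a b → S a b) → ∀ xs → CycLinked R xs → CycLinked S xs
cyclic-map f []      l = Linked.map f l
cyclic-map f (_ ∷ _) l = Linked.map f l

unique-map-injective : ∀ {A B : Set} (f : A → B) {xs} →
  (∀ {x y} → x ∈ xs → y ∈ xs → f x ≡ f y → x ≡ y) → Unique xs → Unique (map f xs)
unique-map-injective f inj [] = []
unique-map-injective f {x ∷ xs} inj (x≢ ∷ u) =
  All.tabulate fresh ∷ unique-map-injective f (λ y∈ z∈ → inj (there y∈) (there z∈)) u
  where
  fresh : ∀ {b} → b ∈ map f xs → f x ≢ b
  fresh b∈ eq with ∈-map⁻ f b∈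
  ... | y , y∈ , eq′ = All.lookup x≢ y∈ (inj (here refl) (there y∈) (trans eq eq′))

module Final {m : ℕ} {s : Word} {N : List Word} (T : Tour (upTo (2 + m)) s N) where

  open Tour T

  n : ℕ
  n = 2 + m

  cycle : List (Perm n)
  cycle = map fromWord N

  edge : ∀ {v w} → upTo n ~ v → upTo n ~ w → Jump v w → EdgeA n (fromWord v) (fromWord w)
  edge ev ew J = jump⇒edge _ _ (subst₂ Jump (sym (word-fromWord ev)) (sym (word-fromWord ew)) J)

  edges : ∀ {a b xs} → (∀ {w} → w ∈ xs → upTo n ~ w) → Path Jump a xs b →
    Path (EdgeA n) (fromWord a) (map fromWord xs) (fromWord b)
  edges h end     = end
  edges h (J ∷ p) = edge (h (here refl)) (h (there (path-head p))) J ∷ edges (h ∘ there) p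

  ∈-cycle⇒InA : ∀ {π} → π ∈ cycle → InA π
  ∈-cycle⇒InA π∈ with ∈-map⁻ fromWord π∈
  ... | w , w∈ , refl = ~⇒InA _ (subst (upTo n ~_) (sym (word-fromWord (sound w∈))) (sound w∈))

  InA⇒∈-cycle : ∀ π → InA π → π ∈ cycle
  InA⇒∈-cycle π π∈A = subst (_∈ cycle) (fromWord-word π (InA⇒~ π π∈A)) (∈-map⁺ fromWord (complete (InA⇒~ π π∈A)))

  cycle-unique : Unique cycle
  cycle-unique = unique-map fromWord word (λ w∈ → word-fromWord (sound w∈)) unique

  cycle-linked : CycLinked (EdgeA n) cycle
  cycle-linked = path-cyclic (edges sound path) (edge (sound (path-last path)) (sound (path-head path)) closing)

  nonempty : 1 ≤ length cycle
  nonempty = positive (InA⇒∈-cycle _ (∈-cycle⇒InA (∈-map⁺ fromWord (path-head path))))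
    where
    positive : ∀ {A : Set} {x : A} {xs} → x ∈ xs → 1 ≤ length xs
    positive (here _)  = s≤s z≤n
    positive (there _) = s≤s z≤n

  hamiltonian : IsHamCycleA n cycle
  hamiltonian = (nonempty , All.tabulate ∈-cycle⇒InA , cycle-unique , cycle-linked) , InA⇒∈-cycle

  good : IsGoodCycleS n cycle
  good = (nonempty , All.tabulate (proj₁ ∘ ∈-cycle⇒InA) , cycle-unique ,
      cyclic-map (λ { (k , _ , 3≤k , k≤n , eq) → k , ≤-trans (n≤1+n 2) 3≤k , k≤n , eq }) cycle cycle-linked) ,
    λ π σ π∈ σ∈ → kendall-even π σ (∈-cycle⇒InA π∈) (∈-cycle⇒InA σ∈)

  -- For a permutation π, the even member of the pair formed by π and π(1 2).
  evenPart : Perm n → Perm n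
  evenPart π = if par (word π) then flip π else π

  evenPart-InA : ∀ π → IsPerm π → InA (evenPart π)
  evenPart-InA π u with par (word π) in eq
  ... | false = ~⇒InA π (word-↭ π u , trans (par-upTo n) (sym eq))
  evenPart-InA (a ∷ b ∷ v) u | true = ~⇒InA (b ∷ a ∷ v) (↭-trans (word-↭ (a ∷ b ∷ v) u) (swap (toℕ a) (toℕ b) refl) ,
    trans (par-upTo n) (sym (trans (par-swap {toℕ a} {toℕ b} (word v) (λ eq′ → unique-head u (here (toℕ-injective eq′)))) (cong not eq))))

  -- An odd and an even permutation with the same even part are flips of each other, hence at
  -- distance 1, which the cycle forbids.
  evenPart-injective : ∀ {c} → IsGoodCycleS n c → ∀ {π σ} → π ∈ c → σ ∈ c → evenPart π ≡ evenPart σ → π ≡ σ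
  evenPart-injective ((_ , perms , _) , far) {π} {σ} π∈ σ∈ eq with par (word π) | par (word σ)
  ... | false | false = eq
  ... | true  | true  = trans (sym (flip-involutive π)) (trans (cong flip eq) (flip-involutive σ))
  ... | true  | false = contradiction (subst (λ ρ → kendall π ρ ≡ 1) eq (kendall-flip π (All.lookup perms π∈))) (far π σ π∈ σ∈)
  ... | false | true  = contradiction (subst (λ ρ → kendall σ ρ ≡ 1) (sym eq) (kendall-flip σ (All.lookup perms σ∈))) (far σ π σ∈ π∈)

  -- Taking even parts injects `c` into the alternating group, all of which `cycle` lists.
  bound : ∀ c → IsGoodCycleS n c → length c ≤ length cycle
  bound c g@((_ , perms , u , _) , _) = subst (_≤ length cycle) (length-map evenPart c)
    (unique-⊆-length (unique-map-injective evenPart (evenPart-injective g) u) even)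
    where
    even : ∀ {ρ} → ρ ∈ map evenPart c → ρ ∈ cycle
    even ρ∈ with ∈-map⁻ evenPart ρ∈
    ... | π , π∈ , refl = InA⇒∈-cycle _ (evenPart-InA π (All.lookup perms π∈))

-- Odd n as 7 + 2i, and the conclusion

odd-form : ∀ n → 7 ≤ n → n % 2 ≡ 1 → ∃ λ i → n ≡ 7 + i * 2
odd-form n 7≤n odd-n with m≤n⇒∃[o]m+o≡n 7≤n
... | o , refl = let i , eq = halve o odd-n in i , cong (7 +_) eq
  where
  halve : ∀ o → (7 + o) % 2 ≡ 1 → ∃ λ i → o ≡ i * 2
  halve zero          _  = 0 , refl
  halve (suc (suc o)) eq = let i , eq′ = halve o eq in suc i , cong (2 +_) eq′

Claim : ℕ → Set
Claim n = (∃ λ (c : List (Perm n)) → IsHamCycleA n c) × MaxGoodCycleLength n (n ! / 2)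

-- The prescribed word is the identity, split off its last letter, and the closing jump is τ_n. The
-- number of words is n!/2 exactly, since its double is n!.
conclude : ∀ m → HalfTours (3 + m) → Claim (3 + m)
conclude m (ℓ , T , half) = finish (Tours.last-tour T (upTo (2 + m)) (2 + m) (subst Unique (sym (upTo-∷ʳ (2 + m))) (Unique.upTo⁺ (3 + m)))
    (trans (cong length (upTo-∷ʳ (2 + m))) (length-upTo (3 + m))))
  where
  finish : (∃ λ N → Tour (upTo (2 + m) ∷ʳ (2 + m)) ((2 + m) ∷ upTo (2 + m)) N × length N ≡ ℓ) → _
  finish (N , T′ , size) = (cycle , hamiltonian) , (cycle , good , len) , λ c g → subst (length c ≤_) len (bound c g)
    where
    open Final (subst (λ t → Tour t ((2 + m) ∷ upTo (2 + m)) N) (upTo-∷ʳ (2 + m)) T′)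
    len : length cycle ≡ (3 + m) ! / 2
    len = trans (length-map fromWord N) (trans size (trans (sym (m*n/n≡m ℓ 2)) (cong (_/ 2) half)))

theorem1 : (n : ℕ) → 7 ≤ n → n % 2 ≡ 1 →
    (∃ λ (c : List (Perm n)) → IsHamCycleA n c) × MaxGoodCycleLength n (n ! / 2)
theorem1 n 7≤n odd-n =
  let i , eq = odd-form n 7≤n odd-n in subst Claim (sym eq) (conclude (4 + i * 2) (half-tours i))
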